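{- Let $N\ge9$ and let $g$ be a matrix over $\mathbb{Z}_N$ with three or four rows and five columns that generates an admissible linear code $C$ which is non-degenerate and not a direct sum. If $C$ is thin, then ($N$ is even and) up to isomorphism $C$ can be generated by the two-row matrix $$\begin{pmatrix}N/2&N/2&0&0&0\\N/2&0&N/2&1&N-1\end{pmatrix}.$$
   Context: $\mathbb{Z}_N=\mathbb{Z}/N\mathbb{Z}$, with elements identified with the representatives $0,\dots,N-1$. A linear code of length $n$ over $\mathbb{Z}_N$ is a submodule of $\mathbb{Z}_N^n$; its elements are words; it is generated by a matrix if it is generated by the rows of the matrix. It is extended if all words have coordinate sum $0\bmod N$. Call a linear code over $\mathbb{Z}_N$ admissible if it is extended and the greatest common divisor of $N$ and all entries of all words is $1$. It is degenerate if some coordinate is zero in all words. An extended code is thin if it contains no word with all entries nonzero. Two codes over the same $\mathbb{Z}_N$ and of the same length are isomorphic if they coincide after a permutation of coordinates. Direct sum: for codes $C_1$ over $\mathbb{Z}_{N_1}$ and $C_2$ over $\mathbb{Z}_{N_2}$, of lengths $\ge1$, with $L=\operatorname{lcm}(N_1,N_2)$, $C_1\oplus C_2$ is the code over $\mathbb{Z}_L$ consisting of all concatenations $\frac{L}{N_1}c_1\,|\,\frac{L}{N_2}c_2$, $c_1\in C_1$, $c_2\in C_2$. A code is a direct sum if it is isomorphic to some $C_1\oplus C_2$. -}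

module Defs where

open import Data.Fin.Base using (Fin; toℕ)
open import Data.Fin.Permutation using (Permutation′; _⟨$⟩ʳ_)
open import Data.Fin.Properties using (toℕ-fromℕ<; toℕ-injective; toℕ<n)
open import Data.Nat.Base using (ℕ; zero; suc; NonZero; _≤_; _∸_; ≢-nonZero; ≢-nonZero⁻¹)
import Data.Nat.Base as ℕ
open import Data.Nat.DivMod using (_/_; _%_; _mod_; m%n<n; m≡m%n+[m/n]*n; [m+kn]%n≡m%n; m<n⇒m%n≡m; m*[n/m]≡n; %-distribˡ-+; %-distribˡ-*)
open import Data.Nat.Divisibility using (_∣_)
open import Data.Nat.LCM using (lcm; gcd*lcm; m∣lcm[m,n]; n∣lcm[m,n])
open import Data.Nat.GCD using (gcd)
import Data.Nat.Properties as ℕₚ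
open import Data.Nat.Tactic.RingSolver using (solve-∀)
open import Data.Product.Base using (∃₂; ∃-syntax; _×_; _,_)
open import Data.Sum.Base using ([_,_]′)
open import Data.Vec.Base using (Vec; []; _∷_; _++_; map; zipWith; replicate; lookup; tabulate; sum)
open import Data.Vec.Properties using (map-++; zipWith-++; map-replicate)
open import Function.Bundles using (_⇔_)
open import Level using (0ℓ)
open import Relation.Binary.PropositionalEquality using (_≡_; _≢_; refl; sym; trans; cong; cong₂; module ≡-Reasoning)
open import Relation.Nullary.Negation using (¬_)
open import Relation.Unary using (Pred)

open ≡-Reasoning

-- ℤ_N is carried by its representatives 0, …, N - 1.
ℤmod : ℕ → Set
ℤmod = Fin

module _ {N : ℕ} .{{_ : NonZero N}} where

  infixl 6 _+ᴺ_
  infixl 7 _*ᴺ_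

  0ᴺ : ℤmod N
  0ᴺ = 0 mod N

  _+ᴺ_ : ℤmod N → ℤmod N → ℤmod N
  a +ᴺ b = (toℕ a ℕ.+ toℕ b) mod N

  _*ᴺ_ : ℤmod N → ℤmod N → ℤmod N
  a *ᴺ b = (toℕ a ℕ.* toℕ b) mod N

  toℕ-mod : ∀ m → toℕ (m mod N) ≡ m % N
  toℕ-mod m = toℕ-fromℕ< (m%n<n m N)

  mod-cong : ∀ {m n} → m % N ≡ n % N → m mod N ≡ n mod N
  mod-cong {m} {n} eq = toℕ-injective (trans (toℕ-mod m) (trans eq (sym (toℕ-mod n))))

  mod-toℕ : ∀ (a : ℤmod N) → toℕ a mod N ≡ a
  mod-toℕ a = toℕ-injective (trans (toℕ-mod (toℕ a)) (m<n⇒m%n≡m (toℕ<n a)))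

  mod-+ : ∀ m n → (m mod N) +ᴺ (n mod N) ≡ (m ℕ.+ n) mod N
  mod-+ m n rewrite toℕ-mod m | toℕ-mod n = mod-cong (sym (%-distribˡ-+ m n N))

  mod-* : ∀ m n → (m mod N) *ᴺ (n mod N) ≡ (m ℕ.* n) mod N
  mod-* m n rewrite toℕ-mod m | toℕ-mod n = mod-cong (sym (%-distribˡ-* m n N))

Word : ℕ → ℕ → Set
Word N n = Vec (ℤmod N) n

Matrix : ℕ → ℕ → ℕ → Set
Matrix N k n = Vec (Word N n) k

module _ {N : ℕ} .{{_ : NonZero N}} {n : ℕ} where

  infixl 6 _+ʷ_
  infixl 7 _·ʷ_

  0ʷ : Word N n
  0ʷ = replicate n 0ᴺ

  _+ʷ_ : Word N n → Word N n → Word N n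
  _+ʷ_ = zipWith _+ᴺ_

  _·ʷ_ : ℤmod N → Word N n → Word N n
  a ·ʷ w = map (a *ᴺ_) w

record LinearCode (N : ℕ) .{{_ : NonZero N}} (n : ℕ) : Set₁ where
  field
    Member   : Pred (Word N n) 0ℓ
    0-closed : Member 0ʷ
    +-closed : ∀ {v w} → Member v → Member w → Member (v +ʷ w)
    ·-closed : ∀ a {w} → Member w → Member (a ·ʷ w)

infix 4 _∈_

_∈_ : ∀ {N} .{{_ : NonZero N}} {n} → Word N n → LinearCode N n → Set
w ∈ C = LinearCode.Member C w

-- The smallest submodule containing the rows of g.
data Span {N : ℕ} .{{_ : NonZero N}} {k n : ℕ} (g : Matrix N k n) : Pred (Word N n) 0ℓ where
  row   : ∀ i → Span g (lookup g i)
  zeroˢ : Span g 0ʷ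
  addˢ  : ∀ {v w} → Span g v → Span g w → Span g (v +ʷ w)
  mulˢ  : ∀ a {w} → Span g w → Span g (a ·ʷ w)

⟨_⟩ : ∀ {N} .{{_ : NonZero N}} {k n} → Matrix N k n → LinearCode N n
⟨ g ⟩ = record { Member = Span g ; 0-closed = zeroˢ ; +-closed = addˢ ; ·-closed = mulˢ }

module _ {N : ℕ} .{{_ : NonZero N}} {n : ℕ} where

  Extended : LinearCode N n → Set
  Extended C = ∀ w → w ∈ C → N ∣ sum (map toℕ w)

  CommonDivisor : LinearCode N n → ℕ → Set
  CommonDivisor C d = d ∣ N × (∀ w → w ∈ C → ∀ i → d ∣ toℕ (lookup w i))

  IsGCD : LinearCode N n → ℕ → Set
  IsGCD C d = CommonDivisor C d × (∀ e → CommonDivisor C e → e ∣ d)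

  Admissible : LinearCode N n → Set
  Admissible C = Extended C × IsGCD C 1

  Degenerate : LinearCode N n → Set
  Degenerate C = ∃[ i ] (∀ w → w ∈ C → lookup w i ≡ 0ᴺ)

  Thin : LinearCode N n → Set
  Thin C = ¬ (∃[ w ] w ∈ C × (∀ i → lookup w i ≢ 0ᴺ))

  permute : Permutation′ n → Word N n → Word N n
  permute π w = tabulate (λ i → lookup w (π ⟨$⟩ʳ i))

  infix 4 _≅_

  _≅_ : LinearCode N n → LinearCode N n → Set
  C ≅ D = ∃[ π ] (∀ w → w ∈ C ⇔ permute π w ∈ D)

lcm-nonZero : ∀ m n .{{_ : NonZero m}} .{{_ : NonZero n}} → NonZero (lcm m n)
lcm-nonZero m n = ≢-nonZero λ eq →
  [ ≢-nonZero⁻¹ m , ≢-nonZero⁻¹ n ]′ (ℕₚ.m*n≡0⇒m≡0∨n≡0 m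
    (trans (sym (gcd*lcm m n)) (trans (cong (gcd m n ℕ.*_) eq) (ℕₚ.*-zeroʳ (gcd m n)))))

-- x ↦ (L/M) x, intended for M ∣ L.
dilate : ∀ {M} .{{_ : NonZero M}} L .{{_ : NonZero L}} → ℤmod M → ℤmod L
dilate {M} L x = ((L / M) ℕ.* toℕ x) mod L

module _ {M L : ℕ} .{{_ : NonZero M}} .{{_ : NonZero L}} (M∣L : M ∣ L) where

  private
    q = L / M

    dilate-mod : ∀ x → dilate {M} L (x mod M) ≡ (q ℕ.* x) mod L
    dilate-mod x = mod-cong (begin
      (q ℕ.* toℕ (x mod M)) % L                   ≡⟨ cong (λ z → (q ℕ.* z) % L) (toℕ-mod x) ⟩
      (q ℕ.* (x % M)) % L                         ≡⟨ [m+kn]%n≡m%n _ (x / M) L ⟨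
      (q ℕ.* (x % M) ℕ.+ (x / M) ℕ.* L) % L       ≡⟨ cong (λ z → (q ℕ.* (x % M) ℕ.+ (x / M) ℕ.* z) % L) (m*[n/m]≡n M∣L) ⟨
      (q ℕ.* (x % M) ℕ.+ (x / M) ℕ.* (M ℕ.* q)) % L ≡⟨ cong (_% L) (rearrange q (x % M) (x / M) M) ⟩
      (q ℕ.* (x % M ℕ.+ (x / M) ℕ.* M)) % L       ≡⟨ cong (λ z → (q ℕ.* z) % L) (m≡m%n+[m/n]*n x M) ⟨
      (q ℕ.* x) % L                               ∎)
      where
      rearrange : ∀ a b c d → a ℕ.* b ℕ.+ c ℕ.* (d ℕ.* a) ≡ a ℕ.* (b ℕ.+ c ℕ.* d)
      rearrange = solve-∀

    swap : ∀ a b c → a ℕ.* (b ℕ.* c) ≡ b ℕ.* (a ℕ.* c)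
    swap = solve-∀

  dilate-0 : dilate {M} L 0ᴺ ≡ 0ᴺ
  dilate-0 = trans (dilate-mod 0) (cong (_mod L) (ℕₚ.*-zeroʳ q))

  dilate-+ : ∀ (x y : ℤmod M) → dilate L (x +ᴺ y) ≡ dilate L x +ᴺ dilate L y
  dilate-+ x y = begin
    dilate L (x +ᴺ y)                         ≡⟨ dilate-mod _ ⟩
    (q ℕ.* (toℕ x ℕ.+ toℕ y)) mod L           ≡⟨ cong (_mod L) (ℕₚ.*-distribˡ-+ q (toℕ x) (toℕ y)) ⟩
    (q ℕ.* toℕ x ℕ.+ q ℕ.* toℕ y) mod L       ≡⟨ mod-+ (q ℕ.* toℕ x) (q ℕ.* toℕ y) ⟨
    dilate L x +ᴺ dilate L y                  ∎

  dilate-* : ∀ (a : ℤmod L) (x : ℤmod M) → dilate L ((toℕ a mod M) *ᴺ x) ≡ a *ᴺ dilate L x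
  dilate-* a x = begin
    dilate L ((toℕ a mod M) *ᴺ x)             ≡⟨ cong (λ z → dilate L ((toℕ a mod M) *ᴺ z)) (mod-toℕ x) ⟨
    dilate L ((toℕ a mod M) *ᴺ (toℕ x mod M)) ≡⟨ cong (dilate L) (mod-* (toℕ a) (toℕ x)) ⟩
    dilate L ((toℕ a ℕ.* toℕ x) mod M)        ≡⟨ dilate-mod _ ⟩
    (q ℕ.* (toℕ a ℕ.* toℕ x)) mod L           ≡⟨ cong (_mod L) (swap q (toℕ a) (toℕ x)) ⟩
    (toℕ a ℕ.* (q ℕ.* toℕ x)) mod L           ≡⟨ mod-* (toℕ a) (q ℕ.* toℕ x) ⟨
    (toℕ a mod L) *ᴺ dilate L x               ≡⟨ cong (_*ᴺ dilate L x) (mod-toℕ a) ⟩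
    a *ᴺ dilate L x                           ∎

  dilateʷ-0 : ∀ n → map (dilate L) (0ʷ {M} {n}) ≡ 0ʷ
  dilateʷ-0 n = trans (map-replicate (dilate L) 0ᴺ n) (cong (replicate n) dilate-0)

  dilateʷ-+ : ∀ {n} (v w : Word M n) → map (dilate L) (v +ʷ w) ≡ map (dilate L) v +ʷ map (dilate L) w
  dilateʷ-+ []      []      = refl
  dilateʷ-+ (x ∷ v) (y ∷ w) = cong₂ _∷_ (dilate-+ x y) (dilateʷ-+ v w)

  dilateʷ-· : ∀ {n} a (w : Word M n) → map (dilate L) ((toℕ a mod M) ·ʷ w) ≡ a ·ʷ map (dilate L) w
  dilateʷ-· a []      = refl
  dilateʷ-· a (x ∷ w) = cong₂ _∷_ (dilate-* a x) (dilateʷ-· a w)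

module _ {N₁ N₂ : ℕ} .{{_ : NonZero N₁}} .{{_ : NonZero N₂}} {n₁ n₂ : ℕ} where

  private
    L = lcm N₁ N₂

    instance
      L≢0 : NonZero L
      L≢0 = lcm-nonZero N₁ N₂

    d₁ = m∣lcm[m,n] N₁ N₂
    d₂ = n∣lcm[m,n] N₁ N₂

    replicate-++ : ∀ {A : Set} m n (x : A) → replicate m x ++ replicate n x ≡ replicate (m ℕ.+ n) x
    replicate-++ zero    n x = refl
    replicate-++ (suc m) n x = cong (x ∷_) (replicate-++ m n x)

  infixr 5 _∣∣_

  _∣∣_ : Word N₁ n₁ → Word N₂ n₂ → Word (lcm N₁ N₂) (n₁ ℕ.+ n₂)
  c₁ ∣∣ c₂ = map (dilate L) c₁ ++ map (dilate L) c₂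

  infixr 5 _⊕_

  _⊕_ : LinearCode N₁ n₁ → LinearCode N₂ n₂ → LinearCode (lcm N₁ N₂) {{lcm-nonZero N₁ N₂}} (n₁ ℕ.+ n₂)
  C₁ ⊕ C₂ = record
    { Member   = λ w → ∃₂ λ c₁ c₂ → c₁ ∈ C₁ × c₂ ∈ C₂ × w ≡ c₁ ∣∣ c₂
    ; 0-closed = 0ʷ , 0ʷ , C₁.0-closed , C₂.0-closed ,
        sym (trans (cong₂ _++_ (dilateʷ-0 d₁ n₁) (dilateʷ-0 d₂ n₂)) (replicate-++ n₁ n₂ 0ᴺ))
    ; +-closed = λ { (a₁ , a₂ , p₁ , p₂ , refl) (b₁ , b₂ , q₁ , q₂ , refl) →
        a₁ +ʷ b₁ , a₂ +ʷ b₂ , C₁.+-closed p₁ q₁ , C₂.+-closed p₂ q₂ ,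
        trans (zipWith-++ _+ᴺ_ (map (dilate L) a₁) _ _ _)
              (sym (cong₂ _++_ (dilateʷ-+ d₁ a₁ b₁) (dilateʷ-+ d₂ a₂ b₂))) }
    ; ·-closed = λ { a (c₁ , c₂ , p₁ , p₂ , refl) →
        (toℕ a mod N₁) ·ʷ c₁ , (toℕ a mod N₂) ·ʷ c₂ , C₁.·-closed (toℕ a mod N₁) p₁ , C₂.·-closed (toℕ a mod N₂) p₂ ,
        trans (map-++ (a *ᴺ_) (map (dilate L) c₁) _)
              (sym (cong₂ _++_ (dilateʷ-· d₁ a c₁) (dilateʷ-· d₂ a c₂))) }
    }
    where
    module C₁ = LinearCode C₁
    module C₂ = LinearCode C₂

-- The indices force N = lcm N₁ N₂ and n = n₁ + n₂.
data IsDirectSum : ∀ {N} .{{_ : NonZero N}} {n} → LinearCode N n → Set₁ where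
  isDirectSum : ∀ {N₁ N₂ n₁ n₂} .{{_ : NonZero N₁}} .{{_ : NonZero N₂}} →
    1 ≤ n₁ → 1 ≤ n₂ →
    (C₁ : LinearCode N₁ n₁) (C₂ : LinearCode N₂ n₂)
    (C : LinearCode (lcm N₁ N₂) {{lcm-nonZero N₁ N₂}} (n₁ ℕ.+ n₂)) →
    _≅_ {{lcm-nonZero N₁ N₂}} C (C₁ ⊕ C₂) →
    IsDirectSum {{lcm-nonZero N₁ N₂}} C

-- Meant for even N only: N / 2 rounds down.
exceptional : ∀ N .{{_ : NonZero N}} → Matrix N 2 5
exceptional N =
  (h ∷ h ∷ o ∷ o ∷ o           ∷ []) ∷
  (h ∷ o ∷ h ∷ e ∷ (N ∸ 1) mod N ∷ []) ∷ []
  where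
  h = (N / 2) mod N
  o = 0 mod N
  e = 1 mod N

{-# OPTIONS --safe #-}

-- C is thin iff it is covered by the five subgroups H i of words vanishing at coordinate i. Discard
-- redundant ones until the cover is irredundant. For w in the intersection of all but l of its members
-- take v avoiding those members: each v + t w lies in one of the l others, and pigeonholing on small t shows
-- that w (l = 1), 2 w (l = 2), or 3 w or 4 w (l = 3) lies in all of them, while l = 4 is impossible for w of
-- order at least 9. C has a word of order N, and a word in at least four of the H i is zero, so covers by
-- five or four subgroups do not occur; nor do covers by two, as C is non-degenerate. Hence three coordinates
-- y₀, y₁, y₂ are 2-torsion with sum 0, and y₃ + y₄ = 0 for the other two. If no y_a with a ≤ 2 equals
-- (N/2) y₃ then C splits as a direct sum; otherwise that relation determines C.
module Submission where

open import Defs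
import Algebra.Properties.CommutativeMonoid.Sum as Sum
open import Data.Empty using (⊥; ⊥-elim)
open import Data.Fin.Base using (Fin; zero; suc; toℕ; cast; punchIn; punchOut; _↑ˡ_; _↑ʳ_)
open import Data.Fin.Patterns using (0F; 1F; 2F; 3F; 4F)
open import Data.Fin.Permutation as Perm using (Permutation′; _⟨$⟩ʳ_; _⟨$⟩ˡ_; inverseʳ; inverseˡ; transpose; _∘ₚ_; insert; insert-punchIn)
open import Data.Fin.Properties using (_≟_; <⇒≢; all?; any?; ¬∀⟶∃¬; pigeonhole; punchIn-punchOut; toℕ<n; toℕ-cast)
open import Data.List.Base using ([]; _∷_)
open import Data.List.Membership.Propositional using () renaming (_∈_ to _∈ˡ_)
import Data.List.Relation.Unary.All as Listᴬ
open import Data.List.Relation.Unary.Any using (here; there)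
open import Data.Nat.Base using (ℕ; zero; suc; NonZero; _≤_; _<_; _+_; _*_; _∸_; pred; z≤n; s≤s; ≢-nonZero; ≢-nonZero⁻¹; >-nonZero⁻¹)
open import Data.Nat.Coprimality using (coprime-divisor; coprime-Bézout; coprime-/gcd)
open import Data.Nat.DivMod using (_/_; _%_; _mod_; /-congˡ; n/n≡1; m/n*n≡m; m≡m%n+[m/n]*n; m%n<n; m%n%n≡m%n; m<n⇒m%n≡m; [m+kn]%n≡m%n; %-distribˡ-+; %-distribˡ-*; %-remove-+ʳ)
open import Data.Nat.Divisibility
open import Data.Nat.GCD using (gcd; gcd[m,n]∣m; gcd[m,n]∣n; gcd[m,n]≢0; gcd-greatest; module Bézout)
open import Data.Nat.LCM using (lcm; lcm-least; m∣lcm[m,n])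
open import Data.Nat.ListAction using (product)
open import Data.Nat.ListAction.Properties using (∈⇒∣product)
open import Data.Nat.Primality using (Prime; euclidsLemma; irreducible[2]; prime[2]; ¬prime[1])
open import Data.Nat.Primality.Factorisation using (factorise; factorisationHasAllPrimeFactors)
open import Data.Nat.Properties using (_<?_; <-≤-trans; <⇒≱; n<1+n; m<m+n; suc-pred; +-0-commutativeMonoid; +-comm; +-assoc; +-identityʳ; *-assoc; *-comm; *-identityˡ; *-identityʳ; *-cancelˡ-≡; *-monoˡ-≤; *-monoʳ-<) renaming (_≟_ to _≟ℕ_)
open import Data.Nat.Tactic.RingSolver using (solve-∀)
open import Data.Product.Base using (∃₂; ∃-syntax; _×_; _,_; proj₁; proj₂)
open import Data.Sum.Base using (_⊎_; inj₁; inj₂)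
open import Data.Vec.Base as Vec using (Vec; []; _∷_; lookup; tabulate; map)
open import Data.Vec.Properties using (tabulate-cong; tabulate∘lookup; lookup∘tabulate; lookup-zipWith; lookup-map; lookup-replicate; lookup-++ˡ; lookup-++ʳ)
import Data.Vec.Relation.Unary.All as All
import Data.Vec.Relation.Unary.AllPairs as AllPairs
open import Data.Vec.Relation.Unary.Unique.Propositional using (Unique)
open import Data.Vec.Relation.Unary.Unique.Propositional.Properties using (lookup-injective)
open import Function.Base using (_∘_; id)
open import Function.Bundles using (_⇔_; mk⇔; Equivalence)
open import Level using (0ℓ)
open import Relation.Binary.PropositionalEquality using (_≡_; _≢_; refl; sym; trans; cong; cong₂; subst; subst₂)
open import Relation.Nullary using (¬_; Dec; yes; no; contradiction; ¬?)
open import Relation.Nullary.Decidable using (True; toWitness; map′; _×-dec_; decidable-stable)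
open import Relation.Unary using (Pred; Decidable)

∣m+n∣n⇒∣m : ∀ {d m n} → d ∣ m + n → d ∣ n → d ∣ m
∣m+n∣n⇒∣m {d} {m} {n} p = ∣m+n∣m⇒∣n (subst (d ∣_) (+-comm m n) p)

2*n≡n+n : ∀ n → 2 * n ≡ n + n
2*n≡n+n = solve-∀

-- Irredundant covers by coordinate hyperplanes

shift : ∀ b t d a → b + (d + t) * a ≡ (b + t * a) + d * a
shift = solve-∀

alternate : ∀ {a b c : Fin 2} → a ≢ b → b ≢ c → a ≡ c
alternate {0F} {0F} a≢b b≢c = contradiction refl a≢b
alternate {0F} {1F} {0F} a≢b b≢c = refl
alternate {0F} {1F} {1F} a≢b b≢c = contradiction refl b≢c
alternate {1F} {1F} a≢b b≢c = contradiction refl a≢b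
alternate {1F} {0F} {1F} a≢b b≢c = refl
alternate {1F} {0F} {0F} a≢b b≢c = contradiction refl b≢c

¬unique : ∀ {k} {xs : Vec (Fin k) (suc k)} → ¬ Unique xs
¬unique {xs = xs} uniq with pigeonhole (n<1+n _) (lookup xs)
... | i , j , i<j , e = <⇒≢ i<j (lookup-injective uniq i j e)

pigeon₃ : ∀ {a b c d : Fin 3} → a ≢ b → a ≢ c → a ≢ d → b ≢ c → b ≢ d → c ≢ d → ⊥
pigeon₃ ab ac ad bc bd cd = ¬unique
  ((ab All.∷ ac All.∷ ad All.∷ All.[]) AllPairs.∷ (bc All.∷ bd All.∷ All.[]) AllPairs.∷
   (cd All.∷ All.[]) AllPairs.∷ All.[] AllPairs.∷ AllPairs.[])

pigeon₄ : ∀ {a b c d e : Fin 4} → a ≢ b → a ≢ c → a ≢ d → a ≢ e → b ≢ c → b ≢ d → b ≢ e →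
          c ≢ d → c ≢ e → d ≢ e → ⊥
pigeon₄ ab ac ad ae bc bd be cd ce de = ¬unique
  ((ab All.∷ ac All.∷ ad All.∷ ae All.∷ All.[]) AllPairs.∷ (bc All.∷ bd All.∷ be All.∷ All.[]) AllPairs.∷
   (cd All.∷ ce All.∷ All.[]) AllPairs.∷ (de All.∷ All.[]) AllPairs.∷ All.[] AllPairs.∷ AllPairs.[])

module Lattice {N n : ℕ} (M : Pred (Fin n → ℕ) 0ℓ)
  (0-mem : M (λ _ → 0))
  (lin : ∀ {f g} → M f → M g → ∀ t → M (λ i → f i + t * g i)) where

  scale : ∀ {f} t → M f → M (λ i → t * f i)
  scale t Mf = lin 0-mem Mf t

  Covers : ∀ {m} → (Fin m → Fin n) → Set
  Covers T = ∀ f → M f → ∃[ x ] N ∣ f (T x)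

  Irredundant : ∀ {m} → (Fin m → Fin n) → Set
  Irredundant T = ∀ x → ∃[ v ] M v × (∀ y → y ≢ x → ¬ N ∣ v (T y))

  module Irr {m} (T : Fin m → Fin n) (cov : Covers T) (irr : Irredundant T) where

    Killed : (Fin n → ℕ) → Set
    Killed w = ∀ x → N ∣ w (T x)

    SupportedOn : ∀ {l} → (Fin l → Fin m) → (Fin n → ℕ) → Set
    SupportedOn S w = ∀ x → (∀ a → x ≢ S a) → N ∣ w (T x)

    restrict : ∀ {l} (S : Fin (suc l) → Fin m) w a → SupportedOn S w → N ∣ w (T (S a)) →
               SupportedOn (S ∘ punchIn a) w
    restrict S w a supp N∣wa x x∉ with x ≟ S a
    ... | yes refl = N∣wa
    ... | no x≢Sa = supp x case
      where
      case : ∀ b → x ≢ S b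
      case b x≡Sb with a ≟ b
      ... | yes refl = x≢Sa x≡Sb
      ... | no a≢b = x∉ (punchOut a≢b) (trans x≡Sb (cong S (sym (punchIn-punchOut a≢b))))

    supp-scale : ∀ {l} (S : Fin l → Fin m) w t → SupportedOn S w → SupportedOn S (λ i → t * w i)
    supp-scale S w t supp x x∉ = ∣n⇒∣m*n t (supp x x∉)

    -- v is nonzero on T outside S, so every v + t w vanishes at some coordinate of S: its colour at time t.
    module Colouring {l} (S : Fin (suc l) → Fin m) w (Mw : M w) (supp : SupportedOn S w) where

      v : Fin n → ℕ
      v = proj₁ (irr (S 0F))

      abstract
        colour : ∀ t → ∃[ a ] N ∣ v (T (S a)) + t * w (T (S a))
        colour t with cov _ (lin (proj₁ (proj₂ (irr (S 0F)))) Mw t)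
        ... | x , N∣ with any? (λ a → x ≟ S a)
        ... | yes (a , refl) = a , N∣
        ... | no x∉ = contradiction
          (∣m+n∣n⇒∣m N∣ (∣n⇒∣m*n t (supp x (λ a e → x∉ (a , e)))))
          (proj₂ (proj₂ (irr (S 0F))) x (λ e → x∉ (0F , e)))

      χ : ℕ → Fin (suc l)
      χ t = proj₁ (colour t)

      recur : ∀ t d → χ t ≡ χ (d + t) → N ∣ d * w (T (S (χ t)))
      recur t d e = ∣m+n∣m⇒∣n
        (subst (N ∣_) (shift _ t d _)
          (subst (λ a → N ∣ v (T (S a)) + (d + t) * w (T (S a))) (sym e) (proj₂ (colour (d + t)))))
        (proj₂ (colour t))

      recur-restrict : ∀ t d → χ t ≡ χ (d + t) → SupportedOn (S ∘ punchIn (χ t)) (λ i → d * w i)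
      recur-restrict t d e = restrict S (λ i → d * w i) (χ t) (supp-scale S w d supp) (recur t d e)

    restrict₂ : ∀ {l} (S : Fin (2 + l) → Fin m) w a b → a ≢ b → SupportedOn S w →
                N ∣ w (T (S a)) → N ∣ w (T (S b)) → ∃[ S′ ] SupportedOn {l} S′ w
    restrict₂ S w a b a≢b supp N∣a N∣b = S ∘ punchIn a ∘ punchIn (punchOut a≢b) ,
      restrict (S ∘ punchIn a) w (punchOut a≢b) (restrict S w a supp N∣a)
        (subst (λ c → N ∣ w (T (S c))) (sym (punchIn-punchOut a≢b)) N∣b)

    killed₁ : (S : Fin 1 → Fin m) → ∀ w → M w → SupportedOn S w → Killed w
    killed₁ S w Mw supp x with x ≟ S 0F
    ... | no x≢ = supp x λ { 0F → x≢ }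
    ... | yes refl with χ 0 | recur 0 1 (unique (χ 0) (χ 1))
      where
      open Colouring S w Mw supp
      unique : (a b : Fin 1) → a ≡ b
      unique 0F 0F = refl
    ... | 0F | N∣ = subst (N ∣_) (*-identityˡ _) N∣

    doubled : ∀ (w : Fin n → ℕ) → Killed (λ i → 1 * w i) → Killed (λ i → 2 * w i)
    doubled w k x = ∣n⇒∣m*n 2 (subst (N ∣_) (*-identityˡ _) (k x))

    killed₂ : (S : Fin 2 → Fin m) → ∀ w → M w → SupportedOn S w → Killed (λ i → 2 * w i)
    killed₂ S w Mw supp with χ 0 ≟ χ 1 | χ 1 ≟ χ 2
      where open Colouring S w Mw supp
    ... | yes e | _ = doubled w (killed₁ _ (λ i → 1 * w i) (scale 1 Mw) (recur-restrict 0 1 e))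
      where
      open Colouring S w Mw supp
    ... | no _ | yes e = doubled w (killed₁ _ (λ i → 1 * w i) (scale 1 Mw) (recur-restrict 1 1 e))
      where
      open Colouring S w Mw supp
    ... | no n₀ | no n₁ = killed₁ _ (λ i → 2 * w i) (scale 2 Mw) (recur-restrict 0 2 (alternate n₀ n₁))
      where
      open Colouring S w Mw supp

    killed₃ : (S : Fin 3 → Fin m) → ∀ w → M w → SupportedOn S w →
              ¬ Killed (λ i → 3 * w i) → ¬ Killed (λ i → 4 * w i) → ⊥
    killed₃ S w Mw supp ¬3 ¬4 = conclude
      where
      open Colouring S w Mw supp
      at : ∀ t d → χ t ≡ χ (d + t) → Killed (λ i → 2 * (d * w i))
      at t d e = killed₂ _ (λ i → d * w i) (scale d Mw) (recur-restrict t d e)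
      near₁ : ∀ t → χ t ≢ χ (1 + t)
      near₁ t e = ¬4 λ x → subst (N ∣_) (lem (w (T x))) (∣n⇒∣m*n 2 (at t 1 e x))
        where
        lem : ∀ a → 2 * (2 * (1 * a)) ≡ 4 * a
        lem = solve-∀
      near₂ : ∀ t → χ t ≢ χ (2 + t)
      near₂ t e = ¬4 λ x → subst (N ∣_) (lem (w (T x))) (at t 2 e x)
        where
        lem : ∀ a → 2 * (2 * a) ≡ 4 * a
        lem = solve-∀
      conclude : ⊥
      conclude with χ 0 ≟ χ 3 | χ 1 ≟ χ 4
      ... | no ne | _ = pigeon₃ (near₁ 0) (near₂ 0) ne (near₁ 1) (near₂ 1) (near₁ 2)
      ... | yes _ | no ne = pigeon₃ (near₁ 1) (near₂ 1) ne (near₁ 2) (near₂ 2) (near₁ 3)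
      ... | yes e | yes e′ =
        let S′ , s = restrict₂ S (λ i → 3 * w i) (χ 0) (χ 1) (near₁ 0) (supp-scale S w 3 supp) (recur 0 3 e) (recur 1 3 e′)
        in ¬3 (killed₁ S′ (λ i → 3 * w i) (scale 3 Mw) s)

    module _ (9≤N : 9 ≤ N) w (Mw : M w) (order : ∀ s → Killed (λ i → s * w i) → N ∣ s) where

      small : ∀ s .{{_ : NonZero s}} {_ : True (s <? 9)} → ¬ N ∣ s
      small s {s<9} = >⇒∤ (<-≤-trans (toWitness s<9) 9≤N)

      ¬supported₃ : (S : Fin 3 → Fin m) → ¬ SupportedOn S w
      ¬supported₃ S supp = killed₃ S w Mw supp (small 3 ∘ order 3) (small 4 ∘ order 4)

      ¬supported₄ : (S : Fin 4 → Fin m) → ¬ SupportedOn S w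
      ¬supported₄ S supp = at₂ 0 1 4 (small 8) (near₁ 0) (period₄ 0) (period₄ 1)
        where
        open Colouring S w Mw supp

        multiple : ∀ s d → Killed (λ i → s * (d * w i)) → N ∣ s * d
        multiple s d k = order (s * d) λ x → subst (N ∣_) (sym (*-assoc s d _)) (k x)

        ¬vanish : ∀ a d → ¬ N ∣ 3 * d → ¬ N ∣ 4 * d → ¬ N ∣ d * w (T (S a))
        ¬vanish a d ¬3 ¬4 N∣ = killed₃ _ (λ i → d * w i) (scale d Mw)
          (restrict S (λ i → d * w i) a (supp-scale S w d supp) N∣) (¬3 ∘ multiple 3 d) (¬4 ∘ multiple 4 d)

        at : ∀ t d → ¬ N ∣ 3 * d → ¬ N ∣ 4 * d → χ t ≢ χ (d + t)
        at t d ¬3 ¬4 e = ¬vanish (χ t) d ¬3 ¬4 (recur t d e)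

        at₂ : ∀ t t′ d → ¬ N ∣ 2 * d → χ t ≢ χ t′ → χ t ≡ χ (d + t) → χ t′ ≢ χ (d + t′)
        at₂ t t′ d ¬2 ne e e′ =
          let S′ , s = restrict₂ S (λ i → d * w i) (χ t) (χ t′) ne (supp-scale S w d supp) (recur t d e) (recur t′ d e′)
          in ¬2 (multiple 2 d (killed₂ S′ (λ i → d * w i) (scale d Mw) s))

        near₁ : ∀ t → χ t ≢ χ (1 + t)
        near₁ t = at t 1 (small 3) (small 4)

        near₂ : ∀ t → χ t ≢ χ (2 + t)
        near₂ t = at t 2 (small 6) (small 8)

        module _ (t : ℕ) (e : χ t ≡ χ (3 + t)) where

          -- A period 3 forces N ∣ 9 or N ∣ 12, a period 5 forces N ∣ 15 or N ∣ 20.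
          ¬period₅ : ∀ t′ → χ t′ ≢ χ (5 + t′)
          ¬period₅ t′ = at t′ 5
            (λ N∣15 → at t 3 (λ N∣9 → small 3 (gcd-greatest N∣9 N∣15)) (λ N∣12 → small 3 (gcd-greatest N∣12 N∣15)) e)
            (λ N∣20 → at t 3 (λ N∣9 → small 1 (gcd-greatest N∣9 N∣20)) (λ N∣12 → small 4 (gcd-greatest N∣12 N∣20)) e)

          ¬period₄ : χ (3 + t) ≢ χ (7 + t)
          ¬period₄ e′ = ¬vanish (χ t) 1 (small 3) (small 4)
            (∣m+n∣m⇒∣n
              (subst (N ∣_) (lem (w (T (S (χ t))))) (subst (λ a → N ∣ 4 * w (T (S a))) (sym e) (recur (3 + t) 4 e′)))
              (recur t 3 e))
            where
            lem : ∀ a → 4 * a ≡ 3 * a + 1 * a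
            lem = solve-∀

          ¬period₃ : ⊥
          ¬period₃ = pigeon₄
            (near₁ (2 + t)) (near₂ (2 + t)) (again (2 + t) (λ e′ → near₁ (2 + t) (trans (sym e′) e))) (¬period₅ (2 + t))
            (near₁ (3 + t)) (near₂ (3 + t)) ¬period₄
            (near₁ (4 + t)) (again (4 + t) (λ e′ → near₁ (3 + t) (trans (sym e) e′)))
            (near₂ (5 + t))
            where
            again : ∀ t′ → χ t ≢ χ t′ → χ t′ ≢ χ (3 + t′)
            again t′ ne = at₂ t t′ 3 (small 6) ne e

        period₄ : ∀ t → χ t ≡ χ (4 + t)
        period₄ t with χ t ≟ χ (4 + t)
        ... | yes e = e
        ... | no ne = ⊥-elim (pigeon₄
          (near₁ t) (near₂ t) (¬period₃ t) ne (near₁ (1 + t)) (near₂ (1 + t)) (¬period₃ (1 + t))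
          (near₁ (2 + t)) (near₂ (2 + t)) (near₁ (3 + t)))

  supported-punchIn : ∀ {m} (T : Fin (suc m) → Fin n) (cov : Covers T) (irr : Irredundant T) z w →
                      N ∣ w (T z) → Irr.SupportedOn T cov irr (punchIn z) w
  supported-punchIn T cov irr z w = Irr.restrict T cov irr (λ x → x) w z (λ x x∉ → contradiction refl (x∉ x))

-- Residues, words and their lifts

lookup-ext : ∀ {A : Set} {n} {xs ys : Vec A n} → (∀ i → lookup xs i ≡ lookup ys i) → xs ≡ ys
lookup-ext {xs = xs} {ys} eq = trans (sym (tabulate∘lookup xs)) (trans (tabulate-cong eq) (tabulate∘lookup ys))

module _ {N : ℕ} .{{_ : NonZero N}} where

  infix 4 _≈_

  _≈_ : ℕ → ℕ → Set
  a ≈ b = a % N ≡ b % N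

  ≈-+ : ∀ {a b c d} → a ≈ b → c ≈ d → a + c ≈ b + d
  ≈-+ {a} {b} {c} {d} p q = trans (%-distribˡ-+ a c N) (trans (cong₂ (λ x y → (x + y) % N) p q) (sym (%-distribˡ-+ b d N)))

  ≈-* : ∀ {a b c d} → a ≈ b → c ≈ d → a * c ≈ b * d
  ≈-* {a} {b} {c} {d} p q = trans (%-distribˡ-* a c N) (trans (cong₂ (λ x y → (x * y) % N) p q) (sym (%-distribˡ-* b d N)))

  ≈-∣ : ∀ {a b} → a ≈ b → N ∣ a → N ∣ b
  ≈-∣ {a} {b} a≈b N∣a = m%n≡0⇒n∣m b N (trans (sym a≈b) (n∣m⇒m%n≡0 a N N∣a))

  ∣⇒≈0 : ∀ {a} → N ∣ a → a ≈ 0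
  ∣⇒≈0 {a} N∣a = trans (n∣m⇒m%n≡0 a N N∣a) (sym (n∣m⇒m%n≡0 0 N (N ∣0)))

  +-cancelʳ-≈ : ∀ {a b} c → a + c ≈ b + c → a ≈ b
  +-cancelʳ-≈ {a} {b} c eq = trans (sym (absorb a)) (trans (≈-+ eq refl) (absorb b))
    where
    lem : ∀ x c p → x + c + c * p ≡ x + c * suc p
    lem = solve-∀
    absorb : ∀ x → x + c + c * pred N ≈ x
    absorb x = trans (cong (_% N) (trans (lem x c (pred N)) (cong (λ n → x + c * n) (suc-pred N)))) ([m+kn]%n≡m%n x c N)

  opposite-≈ : ∀ {a b} c → N ∣ a + c → N ∣ b + c → a ≈ b
  opposite-≈ c p q = +-cancelʳ-≈ c (trans (∣⇒≈0 p) (sym (∣⇒≈0 q)))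

  double-residue : ∀ {a} → N ∣ 2 * a → ¬ N ∣ a → 2 * (a % N) ≡ N
  double-residue {a} N∣2a N∤a with ≈-∣ (≈-* {2} {2} refl (sym (m%n%n≡m%n a N))) N∣2a
  ... | divides zero eq = contradiction (m%n≡0⇒n∣m a N (*-cancelˡ-≡ (a % N) 0 2 eq)) N∤a
  ... | divides 1 eq = trans eq (*-identityˡ N)
  ... | divides (suc (suc q)) eq = contradiction
    (subst (2 * N ≤_) (sym eq) (*-monoˡ-≤ N {2} {2 + q} (s≤s (s≤s z≤n))))
    (<⇒≱ (*-monoʳ-< 2 (m%n<n a N)))

  torsion-≈ : ∀ {a b} → N ∣ 2 * a → N ∣ 2 * b → ¬ N ∣ a → ¬ N ∣ b → a ≈ b
  torsion-≈ p q np nq = *-cancelˡ-≡ _ _ 2 (trans (double-residue p np) (sym (double-residue q nq)))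

  toℕ-+ᴺ : ∀ (a b : ℤmod N) → toℕ (a +ᴺ b) ≈ toℕ a + toℕ b
  toℕ-+ᴺ a b = trans (cong (_% N) (toℕ-mod (toℕ a + toℕ b))) (m%n%n≡m%n _ N)

  toℕ-*ᴺ : ∀ (a b : ℤmod N) → toℕ (a *ᴺ b) ≈ toℕ a * toℕ b
  toℕ-*ᴺ a b = trans (cong (_% N) (toℕ-mod (toℕ a * toℕ b))) (m%n%n≡m%n _ N)

  toℕ-mod≈ : ∀ m → toℕ (m mod N) ≈ m
  toℕ-mod≈ m = trans (cong (_% N) (toℕ-mod m)) (m%n%n≡m%n m N)

  toℕ-injective-≈ : ∀ {a b : ℤmod N} → toℕ a ≈ toℕ b → a ≡ b
  toℕ-injective-≈ {a} {b} eq = trans (sym (mod-toℕ a)) (trans (mod-cong eq) (mod-toℕ b))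

  module _ {n : ℕ} where

    entry : Word N n → Fin n → ℕ
    entry w i = toℕ (lookup w i)

    word : (Fin n → ℕ) → Word N n
    word f = tabulate λ i → f i mod N

    entry-word : ∀ f i → entry (word f) i ≈ f i
    entry-word f i = trans (cong (λ x → toℕ x % N) (lookup∘tabulate (λ j → f j mod N) i)) (toℕ-mod≈ (f i))

    word-ext : ∀ {v w : Word N n} → (∀ i → entry v i ≈ entry w i) → v ≡ w
    word-ext eq = lookup-ext λ i → toℕ-injective-≈ (eq i)

    word-cong : ∀ {f g} → (∀ i → f i ≈ g i) → word f ≡ word g
    word-cong eq = tabulate-cong λ i → mod-cong (eq i)

    word-entry : ∀ w → word (entry w) ≡ w
    word-entry w = word-ext (entry-word (entry w))

    entry-+ : ∀ v w i → entry (v +ʷ w) i ≈ entry v i + entry w i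
    entry-+ v w i = trans (cong (λ x → toℕ x % N) (lookup-zipWith _+ᴺ_ i v w)) (toℕ-+ᴺ (lookup v i) (lookup w i))

    entry-· : ∀ a w i → entry (a ·ʷ w) i ≈ toℕ a * entry w i
    entry-· a w i = trans (cong (λ x → toℕ x % N) (lookup-map i (a *ᴺ_) w)) (toℕ-*ᴺ a (lookup w i))

    entry-0 : ∀ i → entry 0ʷ i ≈ 0
    entry-0 i = trans (cong (λ x → toℕ x % N) (lookup-replicate i 0ᴺ)) (toℕ-mod≈ 0)

  -- Integer representatives make linear combinations of words pointwise and definitional.
  record Lift {n : ℕ} (C : LinearCode N n) (f : Fin n → ℕ) : Set where
    constructor lifted
    field
      member : word f ∈ C

  module _ {n : ℕ} (C : LinearCode N n) where

    lift-resp : ∀ {f g} → (∀ i → f i ≈ g i) → Lift C f → Lift C g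
    lift-resp eq (lifted p) = lifted (subst (_∈ C) (word-cong eq) p)

    lift-0 : Lift C (λ _ → 0)
    lift-0 = lifted (subst (_∈ C) (word-ext λ i → trans (entry-0 i) (sym (entry-word _ i))) (LinearCode.0-closed C))

    lift-lin : ∀ {f g} → Lift C f → Lift C g → ∀ t → Lift C (λ i → f i + t * g i)
    lift-lin {f} {g} (lifted p) (lifted q) t = lifted (subst (_∈ C)
      (word-ext λ i → trans (entry-+ (word f) _ i) (trans
        (≈-+ (entry-word f i) (trans (entry-· (t mod N) (word g) i) (≈-* (toℕ-mod≈ t) (entry-word g i))))
        (sym (entry-word _ i))))
      (LinearCode.+-closed C p (LinearCode.·-closed C (t mod N) q)))

    lift-entry : ∀ {w} → w ∈ C → Lift C (entry w)
    lift-entry {w} p = lifted (subst (_∈ C) (sym (word-entry w)) p)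

    unlift : ∀ {w} → Lift C (entry w) → w ∈ C
    unlift {w} (lifted p) = subst (_∈ C) (word-entry w) p

  module _ {n : ℕ} where

    span-[] : ∀ {w : Word N n} → Span {k = 0} [] w → w ≡ 0ʷ
    span-[] (row ())
    span-[] zeroˢ = refl
    span-[] (addˢ {v} {w} p q) = word-ext λ i → trans (entry-+ v w i) (trans
      (≈-+ (zero-at p i) (zero-at q i)) (sym (entry-0 {n} i)))
      where
      zero-at : ∀ {w : Word N n} → Span {k = 0} [] w → ∀ i → entry w i ≈ 0
      zero-at p i = trans (cong (λ v → entry v i % N) (span-[] p)) (entry-0 {n} i)
    span-[] (mulˢ a {w} p) = word-ext λ i → trans (entry-· a w i) (trans
      (≈-* {toℕ a} refl (trans (cong (λ v → entry v i % N) (span-[] p)) (entry-0 {n} i)))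
      (trans (cong (_% N) (*-comm (toℕ a) 0)) (sym (entry-0 {n} i))))

    entry-comb : ∀ a r w i → entry {n} (a ·ʷ r +ʷ w) i ≈ toℕ a * entry r i + entry w i
    entry-comb a r w i = trans (entry-+ (a ·ʷ r) w i) (≈-+ (entry-· a r i) refl)

    span-∷ : ∀ {k} {r : Word N n} {g : Matrix N k n} {w} → Span (r ∷ g) w →
             ∃₂ λ a w′ → Span g w′ × w ≡ a ·ʷ r +ʷ w′
    span-∷ {r = r} (row zero) = 1 mod N , 0ʷ , zeroˢ , word-ext λ i → sym (trans (entry-comb (1 mod N) r 0ʷ i)
      (trans (≈-+ (≈-* (toℕ-mod≈ 1) refl) (entry-0 {n} i)) (cong (_% N) (lem (entry r i)))))
      where
      lem : ∀ x → 1 * x + 0 ≡ x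
      lem = solve-∀
    span-∷ {r = r} {g} (row (suc j)) = 0 mod N , lookup g j , row j , word-ext λ i → sym (trans (entry-comb (0 mod N) r _ i)
      (≈-+ (≈-* (toℕ-mod≈ 0) (refl {x = entry r i % N})) (refl {x = entry (lookup g j) i % N})))
    span-∷ {r = r} zeroˢ = 0 mod N , 0ʷ , zeroˢ , word-ext λ i → sym (trans (entry-comb (0 mod N) r 0ʷ i)
      (≈-+ (≈-* (toℕ-mod≈ 0) (refl {x = entry r i % N})) (refl {x = entry (0ʷ {n = n}) i % N})))
    span-∷ {r = r} (addˢ p q) with span-∷ p | span-∷ q
    ... | a , v , sv , refl | b , w , sw , refl = a +ᴺ b , v +ʷ w , addˢ sv sw , word-ext λ i → trans
      (trans (entry-+ (a ·ʷ r +ʷ v) (b ·ʷ r +ʷ w) i) (≈-+ (entry-comb a r v i) (entry-comb b r w i)))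
      (trans (cong (_% N) (lem (toℕ a) (toℕ b) (entry r i) (entry v i) (entry w i)))
        (sym (trans (entry-comb (a +ᴺ b) r _ i) (≈-+ (≈-* (toℕ-+ᴺ a b) refl) (entry-+ v w i)))))
      where
      lem : ∀ a b r v w → a * r + v + (b * r + w) ≡ (a + b) * r + (v + w)
      lem = solve-∀
    span-∷ {r = r} (mulˢ c p) with span-∷ p
    ... | a , v , sv , refl = c *ᴺ a , c ·ʷ v , mulˢ c sv , word-ext λ i → trans
      (trans (entry-· c (a ·ʷ r +ʷ v) i) (≈-* {toℕ c} refl (entry-comb a r v i)))
      (trans (cong (_% N) (lem (toℕ c) (toℕ a) (entry r i) (entry v i)))
        (sym (trans (entry-comb (c *ᴺ a) r _ i) (≈-+ (≈-* (toℕ-*ᴺ c a) refl) (entry-· c v i)))))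
      where
      lem : ∀ c a r v → c * (a * r + v) ≡ c * a * r + c * v
      lem = solve-∀

    span-weaken : ∀ {k} {r : Word N n} {g : Matrix N k n} {w} → Span g w → Span (r ∷ g) w
    span-weaken (row i) = row (suc i)
    span-weaken zeroˢ = zeroˢ
    span-weaken (addˢ p q) = addˢ (span-weaken p) (span-weaken q)
    span-weaken (mulˢ a p) = mulˢ a (span-weaken p)

    span-any? : ∀ {k} (g : Matrix N k n) {P : Pred (Word N n) 0ℓ} → Decidable P → Dec (∃[ w ] Span g w × P w)
    span-any? [] {P} P? = map′ (λ p → 0ʷ , zeroˢ , p) (λ { (w , s , p) → subst P (span-[] s) p }) (P? 0ʷ)
    span-any? (r ∷ g) P? = map′
      (λ { (a , w , s , p) → a ·ʷ r +ʷ w , addˢ (mulˢ a (row zero)) (span-weaken s) , p })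
      (λ { (w , s , p) → split s p })
      (any? λ a → span-any? g (λ w → P? (a ·ʷ r +ʷ w)))
      where
      split : ∀ {w} → Span (r ∷ g) w → _ → _
      split s p with span-∷ s
      ... | a , w′ , s′ , refl = a , w′ , s′ , p

    lift-any? : ∀ {k} (g : Matrix N k n) {P : Pred (Fin n → ℕ) 0ℓ} → Decidable P →
                (∀ {f f′} → (∀ i → f i ≈ f′ i) → P f → P f′) → Dec (∃[ f ] Lift ⟨ g ⟩ f × P f)
    lift-any? g P? resp = map′
      (λ { (w , s , p) → entry w , lift-entry ⟨ g ⟩ s , p })
      (λ { (f , lifted s , p) → word f , s , resp (λ i → sym (entry-word f i)) p })
      (span-any? g (λ w → P? (entry w)))

-- Words of order N

prime-divisor : ∀ n .{{_ : NonZero n}} → n ≢ 1 → ∃[ p ] Prime p × p ∣ n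
prime-divisor n n≢1 with factorise n
... | record { factors = [] ; isFactorisation = e } = contradiction e n≢1
... | record { factors = p ∷ ps ; isFactorisation = e ; factorsPrime = pr Listᴬ.∷ _ } =
  p , pr , subst (p ∣_) (sym e) (m∣m*n (product ps))

module _ (N : ℕ) .{{_ : NonZero N}} where

  Primitive : ∀ {m} → (Fin m → ℕ) → Set
  Primitive f = ∀ {p} → Prime p → p ∣ N → ¬ (∀ a → p ∣ f a)

  primitive-divisor : ∀ {m} {f : Fin m → ℕ} → Primitive f → ∀ {d} → d ∣ N → (∀ a → d ∣ f a) → d ≡ 1
  primitive-divisor prim {d} d∣N d∣f with d ≟ℕ 1
  ... | yes e = e
  ... | no d≢1 with prime-divisor d {{≢-nonZero λ { refl → ≢-nonZero⁻¹ N (0∣⇒≡0 d∣N) }}} d≢1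
  ... | p , pr , p∣d = contradiction (λ a → ∣-trans p∣d (d∣f a)) (prim pr (∣-trans p∣d d∣N))

  primitive-order : ∀ {m} {f : Fin m → ℕ} → Primitive f → ∀ t → (∀ a → N ∣ t * f a) → N ∣ t
  primitive-order {f = f} prim t N∣tf = subst (_∣ t) gcd≡N (gcd[m,n]∣n N t)
    where
    instance
      g≢0 : NonZero (gcd N t)
      g≢0 = ≢-nonZero (gcd[m,n]≢0 N t (inj₁ (≢-nonZero⁻¹ N)))
    g = gcd N t
    g∣N = gcd[m,n]∣m N t
    lem : ∀ x y z → x * y * z ≡ x * z * y
    lem = solve-∀
    N/g∣f : ∀ a → N / g ∣ f a
    N/g∣f a = coprime-divisor (coprime-/gcd N t) (m∣n*o⇒m/n∣o g∣N
      (subst (N ∣_) (trans (cong (_* f a) (sym (m/n*n≡m (gcd[m,n]∣n N t)))) (lem (t / g) g (f a))) (N∣tf a)))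
    gcd≡N : g ≡ N
    gcd≡N = trans (sym (*-identityˡ g)) (trans
      (cong (_* g) (sym (primitive-divisor prim (m/n∣m g∣N) N/g∣f))) (m/n*n≡m g∣N))

  primitive-unit : ∀ {x} → Primitive {1} (λ _ → x) → ∃[ t ] t * x % N ≡ 1 % N
  primitive-unit {x} prim with coprime-Bézout {N} {x} (λ { (d∣N , d∣x) → primitive-divisor prim d∣N (λ _ → d∣x) })
  ... | Bézout.-+ q y eq = y , trans (cong (_% N) (sym eq)) ([m+kn]%n≡m%n 1 q N)
  ... | Bézout.+- q y eq = pred N * y , opposite-≈ (pred N)
      (subst (N ∣_) (lem (pred N) y x) (∣n⇒∣m*n (pred N) (subst (N ∣_) (sym eq) (n∣m*n q))))
      (subst (N ∣_) (sym (suc-pred N)) ∣-refl)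
      where
      lem : ∀ p y x → p * (1 + y * x) ≡ p * y * x + p
      lem = solve-∀

  module _ {n : ℕ} (M : Pred (Fin n → ℕ) 0ℓ)
    (0-mem : M (λ _ → 0))
    (lin : ∀ {f g} → M f → M g → ∀ t → M (λ i → f i + t * g i))
    {m : ℕ} (J : Fin m → Fin n) where

    private
      Avoids : ℕ → (Fin n → ℕ) → Set
      Avoids p f = ¬ (∀ a → p ∣ f (J a))

      -- Adding (product ps) f to c changes nothing modulo the primes already dealt with.
      avoid : ∀ ps → Listᴬ.All Prime ps → (∀ {p} → p ∈ˡ ps → ∃[ f ] M f × Avoids p f) →
              ∃[ c ] M c × (∀ {p} → p ∈ˡ ps → Avoids p c)
      avoid [] _ _ = (λ _ → 0) , 0-mem , λ ()
      avoid (p ∷ ps) (pr Listᴬ.∷ prs) each with avoid ps prs (each ∘ there)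
      ... | c , Mc , av with all? (λ a → p ∣? c (J a))
      ... | no ¬all = c , Mc , λ { (here refl) → ¬all ; (there q∈) → av q∈ }
      ... | yes p∣c with each (here refl)
      ... | f , Mf , p∤f = _ , lin Mc Mf (product ps) , λ
        { (here refl) all → p∤f λ a → other a (euclidsLemma (product ps) (f (J a)) pr (∣m+n∣m⇒∣n (all a) (p∣c a)))
        ; (there q∈) all → av q∈ λ a → ∣m+n∣n⇒∣m (all a) (∣m⇒∣m*n (f (J a)) (∈⇒∣product q∈)) }
        where
        other : ∀ a → p ∣ product ps ⊎ p ∣ f (J a) → p ∣ f (J a)
        other a (inj₂ p∣f) = p∣f
        other a (inj₁ p∣Π) = contradiction p∣c (av (factorisationHasAllPrimeFactors pr p∣Π prs))

    primitive-exists : (∀ {p} → Prime p → p ∣ N → ∃[ f ] M f × ¬ (∀ a → p ∣ f (J a))) →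
                       ∃[ c ] M c × Primitive (c ∘ J)
    primitive-exists each with factorise N
    ... | record { factors = ps ; isFactorisation = e ; factorsPrime = prs }
      with avoid ps prs (λ p∈ → each (lookupPrime p∈) (subst (_ ∣_) (sym e) (∈⇒∣product p∈)))
      where
      lookupPrime : ∀ {p} → p ∈ˡ ps → Prime p
      lookupPrime = Listᴬ.lookup prs
    ... | c , Mc , av = c , Mc , λ pr p∣N → av (factorisationHasAllPrimeFactors pr (subst (_ ∣_) e p∣N) prs)

-- Splittings and direct sums

↑-elim : ∀ m {n} {P : Fin (m + n) → Set} → (∀ a → P (a ↑ˡ n)) → (∀ b → P (m ↑ʳ b)) → ∀ i → P i
↑-elim zero    l r i       = r i
↑-elim (suc m) l r zero    = l zero
↑-elim (suc m) l r (suc i) = ↑-elim m (l ∘ suc) r i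

module _ {N : ℕ} .{{_ : NonZero N}} where

  complete-≈ : ∀ {z z′ x y} → z % N ≡ x % N → z′ % N ≡ y % N → (z + 1 * (y + pred N * z′)) % N ≡ x % N
  complete-≈ {z} {z′} {x} {y} p q = trans (≈-+ p (≈-* {a = 1} refl (≈-+ {a = y} refl (≈-* {a = pred N} refl q))))
    (trans (cong (_% N) (trans (lem x (pred N) y) (cong (λ n → x + y * n) (suc-pred N)))) ([m+kn]%n≡m%n x y N))
    where
    lem : ∀ x p y → x + 1 * (y + p * y) ≡ x + y * suc p
    lem = solve-∀

  discard-≈ : ∀ {z z′} y → N ∣ z → N ∣ z′ → (z + 1 * (y + pred N * z′)) % N ≡ y % N
  discard-≈ {z} {z′} y p q = trans
    (≈-+ (∣⇒≈0 p) (≈-* {a = 1} refl (≈-+ {a = y} refl (≈-* {a = pred N} refl (∣⇒≈0 q)))))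
    (cong (_% N) (lem (pred N) y))
    where
    lem : ∀ p y → 0 + 1 * (y + p * 0) ≡ y
    lem = solve-∀

lcm-idem : ∀ n → lcm n n ≡ n
lcm-idem n = ∣-antisym (lcm-least ∣-refl ∣-refl) (m∣lcm[m,n] n n)

entry-permute : ∀ {N} .{{_ : NonZero N}} {n} (π : Permutation′ n) (w : Word N n) i →
                entry (permute π w) i ≡ entry w (π ⟨$⟩ʳ i)
entry-permute π w i = cong toℕ (lookup∘tabulate (λ j → lookup w (π ⟨$⟩ʳ j)) i)

toℕ-dilate : ∀ {M L} .{{_ : NonZero M}} .{{_ : NonZero L}} → M ≡ L → (x : ℤmod M) → toℕ (dilate L x) ≡ toℕ x
toℕ-dilate {M} {L} e x = trans (toℕ-mod (L / M * toℕ x)) (trans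
  (cong (_% L) (trans (cong (_* toℕ x) (trans (/-congˡ (sym e)) (n/n≡1 M))) (*-identityˡ (toℕ x))))
  (m<n⇒m%n≡m (subst (toℕ x <_) e (toℕ<n x))))

module _ {M N : ℕ} .{{_ : NonZero M}} .{{_ : NonZero N}} {m n : ℕ} where

  project : M ≡ N → LinearCode N n → (Fin m → Fin n) → LinearCode M m
  project refl C ι = record
    { Member   = λ c → ∃[ f ] Lift C f × (∀ a → entry c a ≈ f (ι a))
    ; 0-closed = (λ _ → 0) , lift-0 C , entry-0
    ; +-closed = λ { {v} {w} (f , Mf , ef) (g , Mg , eg) → _ , lift-lin C Mf Mg 1 ,
        λ a → trans (entry-+ v w a) (≈-+ (ef a) (trans (eg a) (cong (_% N) (sym (*-identityˡ (g (ι a))))))) }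
    ; ·-closed = λ { t {w} (f , Mf , ef) → _ , lift-lin C (lift-0 C) Mf (toℕ t) ,
        λ a → trans (entry-· t w a) (≈-* {a = toℕ t} refl (ef a)) }
    }

  ∈-project : (e : M ≡ N) (C : LinearCode N n) (ι : Fin m → Fin n) (c : Word M m) →
              c ∈ project e C ι ⇔ (∃[ f ] Lift C f × (∀ a → entry c a % N ≡ f (ι a) % N))
  ∈-project refl C ι c = mk⇔ id id

module _ {n₁ n₂ : ℕ} where

  Splits : ∀ {N} .{{_ : NonZero N}} → LinearCode N (n₁ + n₂) → Permutation′ (n₁ + n₂) → Set
  Splits {N} C σ = ∀ f → Lift C f → ∃[ z ] Lift C z ×
    (∀ a → z (σ ⟨$⟩ʳ (a ↑ˡ n₂)) % N ≡ f (σ ⟨$⟩ʳ (a ↑ˡ n₂)) % N) × (∀ b → N ∣ z (σ ⟨$⟩ʳ (n₁ ↑ʳ b)))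

  private
    splits⇒⊕ : ∀ {M} .{{_ : NonZero M}} → M ≡ lcm M M → 1 ≤ n₁ → 1 ≤ n₂ →
      (C : LinearCode (lcm M M) {{lcm-nonZero M M}} (n₁ + n₂)) (σ : Permutation′ (n₁ + n₂)) →
      Splits {{lcm-nonZero M M}} C σ → IsDirectSum {{lcm-nonZero M M}} C
    splits⇒⊕ {M} d 1≤n₁ 1≤n₂ C σ split =
      isDirectSum 1≤n₁ 1≤n₂ C₁ C₂ C (σ , λ w → mk⇔ (to w) (from w))
      where
      L = lcm M M

      instance
        L≢0 : NonZero L
        L≢0 = lcm-nonZero M M

      left : Fin n₁ → Fin (n₁ + n₂)
      left a = σ ⟨$⟩ʳ (a ↑ˡ n₂)
      right : Fin n₂ → Fin (n₁ + n₂)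
      right b = σ ⟨$⟩ʳ (n₁ ↑ʳ b)
      C₁ : LinearCode M n₁
      C₁ = project d C left
      C₂ : LinearCode M n₂
      C₂ = project d C right

      entry-dilate : ∀ {n} (c : Word M n) a → entry (map (dilate L) c) a ≡ entry c a
      entry-dilate c a = trans (cong toℕ (lookup-map a (dilate L) c)) (toℕ-dilate d (lookup c a))

      entry-left : ∀ (c₁ : Word M n₁) (c₂ : Word M n₂) a → entry (c₁ ∣∣ c₂) (a ↑ˡ n₂) ≡ entry c₁ a
      entry-left c₁ c₂ a = trans (cong toℕ (lookup-++ˡ (map (dilate L) c₁) (map (dilate L) c₂) a)) (entry-dilate c₁ a)

      entry-right : ∀ (c₁ : Word M n₁) (c₂ : Word M n₂) b → entry (c₁ ∣∣ c₂) (n₁ ↑ʳ b) ≡ entry c₂ b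
      entry-right c₁ c₂ b = trans (cong toℕ (lookup-++ʳ (map (dilate L) c₁) (map (dilate L) c₂) b)) (entry-dilate c₂ b)

      restrict : ∀ {n} → Word L (n₁ + n₂) → (Fin n → Fin (n₁ + n₂)) → Word M n
      restrict w ι = tabulate λ a → cast (sym d) (lookup w (ι a))

      entry-restrict : ∀ {n} w (ι : Fin n → Fin (n₁ + n₂)) a → entry (restrict w ι) a ≡ entry w (ι a)
      entry-restrict w ι a = trans (cong toℕ (lookup∘tabulate _ a)) (toℕ-cast (sym d) (lookup w (ι a)))

      to : ∀ w → w ∈ C → permute σ w ∈ C₁ ⊕ C₂
      to w w∈C = restrict w left , restrict w right , member left , member right ,
        word-ext (↑-elim n₁
          (λ a → cong (_% L) (trans (entry-permute σ w (a ↑ˡ n₂))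
            (sym (trans (entry-left (restrict w left) (restrict w right) a) (entry-restrict w left a)))))
          (λ b → cong (_% L) (trans (entry-permute σ w (n₁ ↑ʳ b))
            (sym (trans (entry-right (restrict w left) (restrict w right) b) (entry-restrict w right b))))))
        where
        member : ∀ {n} (ι : Fin n → Fin (n₁ + n₂)) → restrict w ι ∈ project d C ι
        member ι = Equivalence.from (∈-project d C ι _)
          (entry w , lift-entry C w∈C , λ a → cong (_% L) (entry-restrict w ι a))

      from : ∀ w → permute σ w ∈ C₁ ⊕ C₂ → w ∈ C
      from w (c₁ , c₂ , c₁∈ , c₂∈ , eq)
        with Equivalence.to (∈-project d C left c₁) c₁∈ | Equivalence.to (∈-project d C right c₂) c₂∈
      ... | f₁ , Mf₁ , ef₁ | f₂ , Mf₂ , ef₂ with split f₁ Mf₁ | split f₂ Mf₂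
      ... | z₁ , Mz₁ , l₁ , r₁ | z₂ , Mz₂ , l₂ , r₂ =
        unlift C (lift-resp C agree (lift-lin C Mz₁ (lift-lin C Mf₂ Mz₂ (pred L)) 1))
        where
        F : Fin (n₁ + n₂) → ℕ
        F i = z₁ i + 1 * (f₂ i + pred L * z₂ i)
        entry-w : ∀ j → entry w (σ ⟨$⟩ʳ j) ≡ entry (c₁ ∣∣ c₂) j
        entry-w j = trans (sym (entry-permute σ w j)) (cong (λ v → entry v j) eq)
        agreeˡ : ∀ a → F (left a) % L ≡ entry w (left a) % L
        agreeˡ a = trans (complete-≈ {N = L} (l₁ a) (l₂ a))
          (trans (sym (ef₁ a)) (cong (_% L) (sym (trans (entry-w (a ↑ˡ n₂)) (entry-left c₁ c₂ a)))))
        agreeʳ : ∀ b → F (right b) % L ≡ entry w (right b) % L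
        agreeʳ b = trans (discard-≈ {N = L} (f₂ (right b)) (r₁ b) (r₂ b))
          (trans (sym (ef₂ b)) (cong (_% L) (sym (trans (entry-w (n₁ ↑ʳ b)) (entry-right c₁ c₂ b)))))
        agree : ∀ i → F i % L ≡ entry w i % L
        agree i = subst (λ i → F i % L ≡ entry w i % L) (inverseʳ σ) (↑-elim n₁ {P = λ j → F (σ ⟨$⟩ʳ j) % L ≡ entry w (σ ⟨$⟩ʳ j) % L} agreeˡ agreeʳ (σ ⟨$⟩ˡ i))

    transport : ∀ {M N} .{{_ : NonZero M}} .{{_ : NonZero N}} → lcm M M ≡ N → M ≡ N → 1 ≤ n₁ → 1 ≤ n₂ →
      (C : LinearCode N (n₁ + n₂)) (σ : Permutation′ (n₁ + n₂)) → Splits C σ → IsDirectSum C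
    transport refl d 1≤n₁ 1≤n₂ C σ split = splits⇒⊕ d 1≤n₁ 1≤n₂ C σ split

  splits⇒isDirectSum : ∀ {N} .{{_ : NonZero N}} → 1 ≤ n₁ → 1 ≤ n₂ →
    (C : LinearCode N (n₁ + n₂)) (σ : Permutation′ (n₁ + n₂)) → Splits C σ → IsDirectSum C
  splits⇒isDirectSum {N} = transport (lcm-idem N) refl

-- Codes covered by three coordinate hyperplanes

span-least : ∀ {N} .{{_ : NonZero N}} {k n} {g : Matrix N k n} (D : LinearCode N n) →
             (∀ i → lookup g i ∈ D) → ∀ {w} → Span g w → w ∈ D
span-least D rows (row i)    = rows i
span-least D rows zeroˢ      = LinearCode.0-closed D
span-least D rows (addˢ p q) = LinearCode.+-closed D (span-least D rows p) (span-least D rows q)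
span-least D rows (mulˢ a p) = LinearCode.·-closed D a (span-least D rows p)

module _ {N : ℕ} .{{_ : NonZero N}} where

  ∣-resp-≈ : ∀ {p a b} → p ∣ N → a % N ≡ b % N → p ∣ a → p ∣ b
  ∣-resp-≈ {p} p∣N eq p∣a = ∣n∣m%n⇒∣m p∣N (subst (p ∣_) eq (%-presˡ-∣ p∣a p∣N))

module Shape {N : ℕ} .{{_ : NonZero N}} (C : LinearCode N 5) (σ : Permutation′ 5) where

  open Lattice {N} {5} (Lift C) (lift-0 C) (lift-lin C)

  M : Pred (Fin 5 → ℕ) 0ℓ
  M = Lift C

  T : Fin 3 → Fin 5
  T a = σ ⟨$⟩ʳ (a ↑ˡ 2)

  σ3 σ4 : Fin 5
  σ3 = σ ⟨$⟩ʳ 3F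
  σ4 = σ ⟨$⟩ʳ 4F

  coordinates : ∀ {P : Fin 5 → Set} → (∀ a → P (T a)) → P σ3 → P σ4 → ∀ i → P i
  coordinates {P} t p q i = subst P (inverseʳ σ) (↑-elim 3 {P = λ j → P (σ ⟨$⟩ʳ j)} t (λ { 0F → p ; 1F → q }) (σ ⟨$⟩ˡ i))

  module _ (cov : Covers T) (irr : Irredundant T)
    (total : ∀ {f} → M f → N ∣ f (T 0F) + (f (T 1F) + (f (T 2F) + (f σ3 + (f σ4 + 0)))))
    (nondeg : ∀ i → ∃[ f ] M f × ¬ N ∣ f i) where

    open Irr T cov irr

    torsion : ∀ {f} → M f → ∀ a → N ∣ 2 * f (T a)
    torsion {f} Mf with cov f Mf
    ... | z , N∣fz = killed₂ (punchIn z) f Mf (supported-punchIn T cov irr z f N∣fz)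

    Triple : Fin 3 → Fin 3 → Fin 3 → Set
    Triple a b c = ∀ x → x ≡ a ⊎ x ≡ b ⊎ x ≡ c

    third : ∀ {a b c} → Triple a b c → ∀ {f} → M f → N ∣ f (T a) → N ∣ f (T b) → N ∣ f (T c)
    third {a} {b} {c} tri {f} Mf p q = killed₁ (λ _ → c) f Mf supp c
      where
      supp : SupportedOn {1} (λ _ → c) f
      supp x x≢c with tri x
      ... | inj₁ refl = p
      ... | inj₂ (inj₁ refl) = q
      ... | inj₂ (inj₂ x≡c) = contradiction x≡c (x≢c 0F)

    vanish : ∀ {a b c} → Triple a b c → ∀ {f} → M f → ¬ N ∣ f (T a) → ¬ N ∣ f (T b) → N ∣ f (T c)
    vanish tri {f} Mf ¬p ¬q with cov f Mf
    ... | x , N∣fx with tri x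
    ... | inj₁ refl = contradiction N∣fx ¬p
    ... | inj₂ (inj₁ refl) = contradiction N∣fx ¬q
    ... | inj₂ (inj₂ refl) = N∣fx

    rotate : ∀ {a b c} → Triple a b c → Triple b c a
    rotate tri x with tri x
    ... | inj₁ e = inj₂ (inj₂ e)
    ... | inj₂ (inj₁ e) = inj₁ e
    ... | inj₂ (inj₂ e) = inj₂ (inj₁ e)

    triple₀ : Triple 0F 1F 2F
    triple₀ 0F = inj₁ refl
    triple₀ 1F = inj₂ (inj₁ refl)
    triple₀ 2F = inj₂ (inj₂ refl)

    triple-sum : ∀ {a b c} → Triple a b c → ∀ {f} → M f → N ∣ f (T c) → N ∣ f (T a) + f (T b)
    triple-sum {a} {b} {c} tri {f} Mf p with N ∣? f (T a)
    ... | yes q = ∣m∣n⇒∣m+n q (third (rotate (rotate tri)) Mf p q)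
    ... | no ¬q = ≈-∣ (≈-+ {a = f (T a)} refl (torsion-≈ (torsion Mf a) (torsion Mf b) ¬q
                    λ r → ¬q (third (rotate tri) Mf r p)))
                  (subst (N ∣_) (2*n≡n+n (f (T a))) (torsion Mf a))

    sum₃ : ∀ {f} → M f → N ∣ f (T 0F) + f (T 1F) + f (T 2F)
    sum₃ {f} Mf with cov f Mf
    ... | 0F , p = subst (N ∣_) (lem (f (T 0F)) (f (T 1F)) (f (T 2F)))
                     (∣m∣n⇒∣m+n (triple-sum (rotate triple₀) Mf p) p)
      where
      lem : ∀ x y z → y + z + x ≡ x + y + z
      lem = solve-∀
    ... | 1F , p = subst (N ∣_) (lem (f (T 0F)) (f (T 1F)) (f (T 2F)))
                     (∣m∣n⇒∣m+n (triple-sum (rotate (rotate triple₀)) Mf p) p)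
      where
      lem : ∀ x y z → z + x + y ≡ x + y + z
      lem = solve-∀
    ... | 2F , p = ∣m∣n⇒∣m+n (triple-sum triple₀ Mf p) p

    sum₂ : ∀ {f} → M f → N ∣ f σ3 + f σ4
    sum₂ {f} Mf = ∣m+n∣m⇒∣n (subst (N ∣_) (lem (f (T 0F)) (f (T 1F)) (f (T 2F)) (f σ3) (f σ4)) (total Mf)) (sum₃ Mf)
      where
      lem : ∀ x y z v w → x + (y + (z + (v + (w + 0)))) ≡ x + y + z + (v + w)
      lem = solve-∀

    2∣N : 2 ∣ N
    2∣N with nondeg (T 0F)
    ... | f , Mf , N∤f = divides (f (T 0F) % N) (sym (trans (*-comm (f (T 0F) % N) 2) (double-residue (torsion Mf 0F) N∤f)))

    h : ℕ
    h = N / 2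

    2h≡N : 2 * h ≡ N
    2h≡N = trans (*-comm 2 h) (m/n*n≡m 2∣N)

    instance
      h≢0 : NonZero h
      h≢0 = ≢-nonZero λ h≡0 → ≢-nonZero⁻¹ N (trans (sym 2h≡N) (cong (2 *_) h≡0))

    N∤h : ¬ N ∣ h
    N∤h = >⇒∤ (subst (h <_) 2h≡N (m<m+n h (subst (0 <_) (sym (+-identityʳ h)) (>-nonZero⁻¹ h))))

    ≈h : ∀ {f} → M f → ∀ a → ¬ N ∣ f (T a) → f (T a) % N ≡ h % N
    ≈h Mf a ¬p = torsion-≈ (torsion Mf a) (subst (N ∣_) (sym 2h≡N) ∣-refl) ¬p N∤h

    kernel-hit : (∀ a → ∃[ k ] M k × N ∣ k σ3 × ¬ N ∣ k (T a)) → ∀ {a b c} → Triple a b c →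
                 ∃[ z ] M z × N ∣ z σ3 × N ∣ z (T c) × ¬ N ∣ z (T a)
    kernel-hit ker {a} {b} {c} tri with ker a | ker b
    ... | k , Mk , k3 , ka | l , Ml , l3 , lb with N ∣? k (T c) | N ∣? l (T c)
    ... | yes kc | _ = k , Mk , k3 , kc , ka
    ... | no _ | yes lc = l , Ml , l3 , lc , λ la → lb (third (rotate (rotate tri)) Ml lc la)
    ... | no ¬kc | no ¬lc = (λ i → k i + 1 * l i) , lift-lin C Mk Ml 1 , ∣m∣n⇒∣m+n k3 (∣n⇒∣m*n 1 l3) ,
      ≈-∣ (≈-+ {a = k (T c)} refl (trans (torsion-≈ (torsion Mk c) (torsion Ml c) ¬kc ¬lc) (cong (_% N) (sym (*-identityˡ (l (T c)))))))
        (subst (N ∣_) (2*n≡n+n (k (T c))) (torsion Mk c)) ,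
      λ p → ka (∣m+n∣n⇒∣m p (∣n⇒∣m*n 1 (vanish (rotate tri) Ml lb ¬lc)))

    kernel-splits-at : (∀ a → ∃[ k ] M k × N ∣ k σ3 × ¬ N ∣ k (T a)) → ∀ {a b c} → Triple a b c →
      ∀ {f} → M f → N ∣ f (T c) →
      ∃[ z ] M z × (∀ x → z (T x) % N ≡ f (T x) % N) × (∀ b → N ∣ z (σ ⟨$⟩ʳ (3 ↑ʳ b)))
    kernel-splits-at ker {a} {b} {c} tri {f} Mf fc with N ∣? f (T a)
    ... | yes fa = (λ _ → 0) , lift-0 C , (λ x → sym (∣⇒≈0 (zeros x))) , λ _ → N ∣0
      where
      zeros : ∀ x → N ∣ f (T x)
      zeros x with tri x
      ... | inj₁ refl = fa
      ... | inj₂ (inj₁ refl) = third (rotate (rotate tri)) Mf fc fa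
      ... | inj₂ (inj₂ refl) = fc
    ... | no ¬fa with kernel-hit ker tri
    ... | z , Mz , z3 , zc , ¬za = z , Mz , agree , λ { 0F → z3 ; 1F → ∣m+n∣m⇒∣n (sum₂ Mz) z3 }
      where
      agree : ∀ x → z (T x) % N ≡ f (T x) % N
      agree x with tri x
      ... | inj₁ refl = torsion-≈ (torsion Mz a) (torsion Mf a) ¬za ¬fa
      ... | inj₂ (inj₁ refl) = torsion-≈ (torsion Mz b) (torsion Mf b)
              (λ zb → ¬za (third (rotate tri) Mz zb zc)) (λ fb → ¬fa (third (rotate tri) Mf fb fc))
      ... | inj₂ (inj₂ refl) = trans (∣⇒≈0 zc) (sym (∣⇒≈0 fc))

    kernel-splits : (∀ a → ∃[ k ] M k × N ∣ k σ3 × ¬ N ∣ k (T a)) → Splits {3} {2} C σ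
    kernel-splits ker f Mf with cov f Mf
    ... | 0F , p = kernel-splits-at ker (rotate triple₀) Mf p
    ... | 1F , p = kernel-splits-at ker (rotate (rotate triple₀)) Mf p
    ... | 2F , p = kernel-splits-at ker triple₀ Mf p

    module _ (avoid : ∀ {p} → Prime p → p ∣ N → ∃[ f ] M f × ¬ (∀ i → p ∣ f i)) where

      even-splits : (∀ {f} → M f → 2 ∣ f σ3) → Splits {3} {2} C σ
      even-splits even f Mf = (λ i → h * f i) , Mhf , agree , λ { 0F → hf3 ; 1F → ∣m+n∣m⇒∣n (sum₂ Mhf) hf3 }
        where
        Mhf : M (λ i → h * f i)
        Mhf = lift-lin C (lift-0 C) Mf h
        hf3 : N ∣ h * f σ3
        hf3 = subst (_∣ h * f σ3) (trans (*-comm h 2) 2h≡N) (*-monoʳ-∣ h (even Mf))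
        2∤h : ¬ 2 ∣ h
        2∤h 2∣h with avoid prime[2] 2∣N
        ... | c , Mc , ¬all = ¬all (coordinates
          (λ a → ∣-trans 2∣h (*-cancelˡ-∣ 2 (subst (_∣ 2 * c (T a)) (sym 2h≡N) (torsion Mc a))))
          (even Mc) (∣m+n∣m⇒∣n (∣-trans 2∣N (sum₂ Mc)) (even Mc)))
        odd : h ≡ 1 + h / 2 * 2
        odd with h % 2 in e | m%n<n h 2
        ... | 0 | _ = contradiction (m%n≡0⇒n∣m h 2 e) 2∤h
        ... | 1 | _ = trans (m≡m%n+[m/n]*n h 2) (cong (_+ h / 2 * 2) e)
        ... | suc (suc _) | s≤s (s≤s ())
        agree : ∀ a → h * f (T a) % N ≡ f (T a) % N
        agree a = trans (cong (λ x → x * f (T a) % N) odd) (trans (cong (_% N) (lem (h / 2) (f (T a))))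
          (%-remove-+ʳ (f (T a)) (∣n⇒∣m*n (h / 2) (torsion Mf a))))
          where
          lem : ∀ j x → (1 + j * 2) * x ≡ x + j * (2 * x)
          lem = solve-∀

      unit-exists : ∀ {f} → M f → ¬ 2 ∣ f σ3 → ∃[ u ] M u × u σ3 % N ≡ 1 % N
      unit-exists {f} Mf 2∤f with primitive-exists N M (lift-0 C) (lift-lin C) {1} (λ _ → σ3) each
        where
        each : ∀ {p} → Prime p → p ∣ N → ∃[ f ] M f × ¬ (Fin 1 → p ∣ f σ3)
        each {p} pr p∣N with p ≟ℕ 2
        ... | yes refl = f , Mf , λ all → 2∤f (all 0F)
        ... | no p≢2 with avoid pr p∣N
        ... | k , Mk , ¬all = k , Mk , λ all → ¬all (coordinates (at ∘ torsion′) (all 0F)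
                (∣m+n∣m⇒∣n (∣-trans p∣N (sum₂ Mk)) (all 0F)))
          where
          torsion′ : ∀ a → p ∣ 2 * k (T a)
          torsion′ a = ∣-trans p∣N (torsion Mk a)
          at : ∀ {x} → p ∣ 2 * x → p ∣ x
          at {x} p∣2x with euclidsLemma 2 x pr p∣2x
          ... | inj₂ p∣x = p∣x
          ... | inj₁ p∣2 with irreducible[2] p∣2
          ... | inj₁ refl = contradiction pr ¬prime[1]
          ... | inj₂ p≡2 = contradiction p≡2 p≢2
      ... | c , Mc , prim with primitive-unit N prim
      ... | t , eq = (λ i → t * c i) , lift-lin C (lift-0 C) Mc t , eq

    module _ {u : Fin 5 → ℕ} (Mu : M u) (u3≈1 : u σ3 % N ≡ 1 % N) where

      reduce : (Fin 5 → ℕ) → Fin 5 → ℕ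
      reduce f i = f i + pred N * f σ3 * u i

      reduce-∈ : ∀ {f} → M f → M (reduce f)
      reduce-∈ {f} Mf = lift-lin C Mf Mu (pred N * f σ3)

      N∣multiple : ∀ y z → N ∣ y * z + pred N * y * z
      N∣multiple y z = subst (N ∣_) (lem y z (pred N)) (∣n⇒∣m*n (y * z) (subst (N ∣_) (sym (suc-pred N)) ∣-refl))
        where
        lem : ∀ y z p → y * z * suc p ≡ y * z + p * y * z
        lem = solve-∀

      reduce-∣ : ∀ {f i} → f i % N ≡ f σ3 * u i % N → N ∣ reduce f i
      reduce-∣ {f} {i} eq = ≈-∣ (sym (≈-+ eq refl)) (N∣multiple (f σ3) (u i))

      reduce-≈ : ∀ {f i} → N ∣ reduce f i → f i % N ≡ f σ3 * u i % N
      reduce-≈ {f} {i} p = opposite-≈ (pred N * f σ3 * u i) p (N∣multiple (f σ3) (u i))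

      reduce-σ3 : ∀ f → N ∣ reduce f σ3
      reduce-σ3 f = reduce-∣ {f} (sym (trans (≈-* {a = f σ3} refl u3≈1) (cong (_% N) (*-identityʳ (f σ3)))))

      forced : ∀ a → (∀ {f} → M f → N ∣ f σ3 → N ∣ f (T a)) → ∀ {f} → M f → f (T a) % N ≡ f σ3 * h % N
      forced a ker {f} Mf = trans (rel Mf) (≈-* {a = f σ3} refl (≈h Mu a N∤ua))
        where
        rel : ∀ {f} → M f → f (T a) % N ≡ f σ3 * u (T a) % N
        rel {f} Mf = reduce-≈ {f} (ker (reduce-∈ Mf) (reduce-σ3 f))
        N∤ua : ¬ N ∣ u (T a)
        N∤ua N∣ua with nondeg (T a)
        ... | k , Mk , N∤k = N∤k (≈-∣ (sym (rel Mk)) (∣n⇒∣m*n (k σ3) N∣ua))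

      module _ (rel : ∀ {f} → M f → f (T 2F) % N ≡ f σ3 * h % N) where

        row₀ row₁ : Fin 5 → ℕ
        row₀ 0F = h
        row₀ 1F = h
        row₀ 2F = 0
        row₀ 3F = 0
        row₀ 4F = 0
        row₁ 0F = h
        row₁ 1F = 0
        row₁ 2F = h
        row₁ 3F = 1
        row₁ 4F = N ∸ 1

        N∣1+ : N ∣ N ∸ 1 + 1
        N∣1+ = subst (N ∣_) (trans (sym (suc-pred N)) (+-comm 1 (pred N))) ∣-refl

        row₀-∈ : ∃[ f ] M f × (∀ a → f (σ ⟨$⟩ʳ a) % N ≡ row₀ a % N)
        row₀-∈ with irr 2F
        ... | v , Mv , ¬v = reduce v , Mr , λ
          { 0F → trans (%-remove-+ʳ (v (T 0F)) (kill 0F)) (≈h Mv 0F (¬v 0F λ ()))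
          ; 1F → trans (%-remove-+ʳ (v (T 1F)) (kill 1F)) (≈h Mv 1F (¬v 1F λ ()))
          ; 2F → ∣⇒≈0 (∣m∣n⇒∣m+n v2 (kill 2F))
          ; 3F → ∣⇒≈0 (reduce-σ3 v)
          ; 4F → ∣⇒≈0 (∣m+n∣m⇒∣n (sum₂ Mr) (reduce-σ3 v)) }
          where
          Mr : M (reduce v)
          Mr = reduce-∈ Mv
          v2 : N ∣ v (T 2F)
          v2 = vanish triple₀ Mv (¬v 0F λ ()) (¬v 1F λ ())
          kill : ∀ a → N ∣ pred N * v σ3 * u (T a)
          kill a with N ∣? u (T a)
          ... | yes p = ∣n⇒∣m*n (pred N * v σ3) p
          ... | no ¬p = subst (N ∣_) (sym (*-assoc (pred N) (v σ3) (u (T a)))) (∣n⇒∣m*n (pred N)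
                  (≈-∣ (trans (rel Mv) (≈-* {a = v σ3} refl (sym (≈h Mu a ¬p)))) v2))

        u2≈h : u (T 2F) % N ≡ h % N
        u2≈h = trans (rel Mu) (trans (≈-* u3≈1 (refl {x = h % N})) (cong (_% N) (*-identityˡ h)))

        N∤u2 : ¬ N ∣ u (T 2F)
        N∤u2 p = N∤h (≈-∣ u2≈h p)

        u4 : ∀ {f} → M f → f σ3 % N ≡ 1 % N → f σ4 % N ≡ (N ∸ 1) % N
        u4 {f} Mf e = opposite-≈ 1 (≈-∣ (trans (≈-+ e refl) (cong (_% N) (+-comm 1 (f σ4)))) (sum₂ Mf)) N∣1+

        row₁-∈ : ∃[ f ] M f × (∀ a → f (σ ⟨$⟩ʳ a) % N ≡ row₁ a % N)
        row₁-∈ with N ∣? u (T 1F)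
        ... | yes u1 = u , Mu , λ
          { 0F → ≈h Mu 0F (λ u0 → N∤u2 (third triple₀ Mu u0 u1)) ; 1F → ∣⇒≈0 u1 ; 2F → u2≈h ; 3F → u3≈1 ; 4F → u4 Mu u3≈1 }
        ... | no ¬u1 with row₀-∈
        ... | e , Me , eq = _ , lift-lin C Mu Me 1 , λ
          { 0F → ≈-+ (∣⇒≈0 (vanish (rotate triple₀) Mu ¬u1 N∤u2)) (e* 0F)
          ; 1F → trans (≈-+ (≈h Mu 1F ¬u1) (e* 1F)) (∣⇒≈0 (subst (N ∣_) (trans (sym 2h≡N) (2*n≡n+n h)) ∣-refl))
          ; 2F → trans (≈-+ u2≈h (e* 2F)) (cong (_% N) (+-identityʳ h))
          ; 3F → e3
          ; 4F → u4 (lift-lin C Mu Me 1) e3 }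
          where
          e* : ∀ a → 1 * e (σ ⟨$⟩ʳ a) % N ≡ row₀ a % N
          e* a = trans (cong (_% N) (*-identityˡ (e (σ ⟨$⟩ʳ a)))) (eq a)
          e3 : (u σ3 + 1 * e σ3) % N ≡ 1 % N
          e3 = ≈-+ u3≈1 (e* 3F)

        combination : ∀ {f} → M f → ∃[ s ] ∀ a → f (σ ⟨$⟩ʳ a) % N ≡ (s * row₀ a + f σ3 * row₁ a) % N
        combination {f} Mf = proj₁ coefficient , λ
          { 0F → opposite-≈ (s * h + t * h)
                   (≈-∣ (trans (≈-+ (≈-+ {a = f (T 0F)} refl f1) (rel Mf)) (cong (_% N) (+-assoc (f (T 0F)) (s * h) (t * h)))) (sum₃ Mf))
                   (subst (N ∣_) (trans (cong ((s + t) *_) (sym 2h≡N)) (lem₀ s t h)) (n∣m*n (s + t)))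
          ; 1F → trans f1 (cong (_% N) (lem₁ (s * h) t))
          ; 2F → trans (rel Mf) (cong (_% N) (lem₂ s (t * h)))
          ; 3F → cong (_% N) (lem₃ s t)
          ; 4F → opposite-≈ t (subst (N ∣_) (+-comm t (f σ4)) (sum₂ Mf))
                   (subst (N ∣_) (lem₄ s t (N ∸ 1)) (∣n⇒∣m*n t N∣1+)) }
          where
          coefficient : ∃[ s ] f (T 1F) % N ≡ s * h % N
          coefficient with N ∣? f (T 1F)
          ... | yes p = 0 , ∣⇒≈0 p
          ... | no ¬p = 1 , trans (≈h Mf 1F ¬p) (cong (_% N) (sym (*-identityˡ h)))
          s = proj₁ coefficient
          f1 = proj₂ coefficient
          t = f σ3
          lem₀ : ∀ s t h → (s + t) * (2 * h) ≡ s * h + t * h + (s * h + t * h)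
          lem₀ = solve-∀
          lem₁ : ∀ x t → x ≡ x + t * 0
          lem₁ = solve-∀
          lem₂ : ∀ s x → x ≡ s * 0 + x
          lem₂ = solve-∀
          lem₃ : ∀ s t → t ≡ s * 0 + t * 1
          lem₃ = solve-∀
          lem₄ : ∀ s t p → t * (p + 1) ≡ s * 0 + t * p + t
          lem₄ = solve-∀

        ≅-exceptional : C ≅ ⟨ exceptional N ⟩
        ≅-exceptional = σ , λ w → mk⇔ (to w) (from w)
          where
          to : ∀ w → w ∈ C → permute σ w ∈ ⟨ exceptional N ⟩
          to w w∈C = subst (_∈ ⟨ exceptional N ⟩) eq (Lift.member comb)
            where
            E = ⟨ exceptional N ⟩
            r₀ : Lift E row₀
            r₀ = lifted (row 0F)
            r₁ : Lift E row₁
            r₁ = lifted (row 1F)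
            t = entry w σ3
            solution = combination (lift-entry C w∈C)
            s = proj₁ solution
            comb : Lift E (λ a → s * row₀ a + t * row₁ a)
            comb = lift-lin E (lift-lin E (lift-0 E) r₀ s) r₁ t
            eq : word (λ a → s * row₀ a + t * row₁ a) ≡ permute σ w
            eq = word-ext λ a → trans (entry-word (λ a → s * row₀ a + t * row₁ a) a)
              (trans (sym (proj₂ solution a)) (cong (_% N) (sym (entry-permute σ w a))))
          from : ∀ w → permute σ w ∈ ⟨ exceptional N ⟩ → w ∈ C
          from w p with span-least (project refl C (σ ⟨$⟩ʳ_)) (λ
            { 0F → proj₁ row₀-∈ , proj₁ (proj₂ row₀-∈) , λ a → trans (entry-word row₀ a) (sym (proj₂ (proj₂ row₀-∈) a))
            ; 1F → proj₁ row₁-∈ , proj₁ (proj₂ row₁-∈) , λ a → trans (entry-word row₁ a) (sym (proj₂ (proj₂ row₁-∈) a)) }) p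
          ... | f , Mf , eq = unlift C (lift-resp C (λ i → subst (λ i → f i % N ≡ entry w i % N) (inverseʳ σ)
                (trans (sym (eq (σ ⟨$⟩ˡ i))) (cong (_% N) (entry-permute σ w (σ ⟨$⟩ˡ i))))) Mf)

-- Reduction to three hyperplanes

open Sum +-0-commutativeMonoid using (sum; sum-permute; sum-remove)

sum-lookup : ∀ {m n} (w : Vec (Fin m) n) → Vec.sum (Vec.map toℕ w) ≡ sum (λ i → toℕ (lookup w i))
sum-lookup []      = refl
sum-lookup (x ∷ w) = cong (toℕ x +_) (sum-lookup w)

∣-sum : ∀ {d n} {f : Fin n → ℕ} → (∀ i → d ∣ f i) → d ∣ sum f
∣-sum {n = zero}  d∣f = _ ∣0
∣-sum {n = suc n} d∣f = ∣m∣n⇒∣m+n (d∣f zero) (∣-sum (d∣f ∘ suc))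

sum-≈ : ∀ {N} .{{_ : NonZero N}} {n} {f g : Fin n → ℕ} → (∀ i → f i % N ≡ g i % N) → sum f % N ≡ sum g % N
sum-≈ {n = zero}  eq = refl
sum-≈ {n = suc n} eq = ≈-+ (eq zero) (sum-≈ (eq ∘ suc))

module _ {N : ℕ} .{{_ : NonZero N}} {k n : ℕ} (g : Matrix N k n) where

  private
    M : Pred (Fin n → ℕ) 0ℓ
    M = Lift ⟨ g ⟩

  open Lattice {N} {n} M (lift-0 ⟨ g ⟩) (lift-lin ⟨ g ⟩)

  extended-sum : Extended ⟨ g ⟩ → ∀ {f} → M f → N ∣ sum f
  extended-sum ext {f} (lifted p) = ≈-∣ (sum-≈ (entry-word f)) (subst (N ∣_) (sum-lookup (word f)) (ext (word f) p))

  nonDegenerate : ¬ Degenerate ⟨ g ⟩ → ∀ i → ∃[ f ] M f × ¬ N ∣ f i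
  nonDegenerate ¬deg i with lift-any? g (λ f → ¬? (N ∣? f i)) (λ eq N∤f N∣f′ → N∤f (≈-∣ (sym (eq i)) N∣f′))
  ... | yes found = found
  ... | no none = contradiction
    (i , λ w w∈ → toℕ-injective-≈ (trans
      (∣⇒≈0 (decidable-stable (N ∣? entry w i) λ N∤ → none (entry w , lift-entry ⟨ g ⟩ w∈ , N∤))) (sym (toℕ-mod≈ 0)))) ¬deg

  prime-avoided : IsGCD ⟨ g ⟩ 1 → ∀ {p} → Prime p → p ∣ N → ∃[ f ] M f × ¬ (∀ i → p ∣ f i)
  prime-avoided (_ , greatest) {p} pr p∣N
    with lift-any? g (λ f → ¬? (all? λ i → p ∣? f i)) (λ eq ¬all all → ¬all λ i → ∣-resp-≈ p∣N (sym (eq i)) (all i))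
  ... | yes found = found
  ... | no none = contradiction (subst Prime (∣1⇒≡1 (greatest p (p∣N , divides-all))) pr) ¬prime[1]
    where
    divides-all : ∀ w → w ∈ ⟨ g ⟩ → ∀ i → p ∣ entry w i
    divides-all w w∈ = decidable-stable (all? λ i → p ∣? entry w i) λ ¬all → none (entry w , lift-entry ⟨ g ⟩ w∈ , ¬all)

  thin-covers : Thin ⟨ g ⟩ → Covers id
  thin-covers thin f (lifted p) with any? (λ i → N ∣? f i)
  ... | yes found = found
  ... | no none = contradiction (word f , p , λ i e → none (i , ≈-∣ (sym (trans
      (sym (entry-word f i)) (trans (cong (λ x → toℕ x % N) e) (toℕ-mod≈ 0)))) (N ∣0))) thin

  irredundant-at? : ∀ {m} (T : Fin (suc m) → Fin n) x → Dec (∃[ f ] M f × (∀ y → ¬ N ∣ f (T (punchIn x y))))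
  irredundant-at? T x = lift-any? g (λ f → all? λ y → ¬? (N ∣? f (T (punchIn x y)))) (λ eq p y → p y ∘ ≈-∣ (sym (eq _)))

  covers-step : ∀ {m} (T : Fin (suc m) → Fin n) → Covers T → Irredundant T ⊎ (∃[ x ] Covers (T ∘ punchIn x))
  covers-step {m} T cov with all? (irredundant-at? T)
  ... | yes found = inj₁ λ x → let v , Mv , p = found x in v , Mv , λ y y≢x →
          subst (λ z → ¬ N ∣ v (T z)) (punchIn-punchOut (y≢x ∘ sym)) (p (punchOut (y≢x ∘ sym)))
  ... | no ¬found with ¬∀⟶∃¬ (suc m) _ (irredundant-at? T) ¬found
  ... | x , none = inj₂ (x , λ f Mf → decidable-stable (any? λ y → N ∣? f (T (punchIn x y)))
          λ ¬any → none (f , Mf , λ y p → ¬any (y , p)))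

  ¬covers₂ : (∀ i → ∃[ f ] M f × ¬ N ∣ f i) → (T : Fin 2 → Fin n) → ¬ Covers T
  ¬covers₂ nondeg T cov with nondeg (T 0F) | nondeg (T 1F)
  ... | f , Mf , ¬f | f′ , Mf′ , ¬f′ with cov f Mf | cov f′ Mf′
  ... | 0F , p | _      = ¬f p
  ... | 1F , p | 1F , q = ¬f′ q
  ... | 1F , p | 0F , q with cov _ (lift-lin ⟨ g ⟩ Mf Mf′ 1)
  ... | 0F , r = ¬f (∣m+n∣n⇒∣m r (∣n⇒∣m*n 1 q))
  ... | 1F , r = ¬f′ (subst (N ∣_) (*-identityˡ _) (∣m+n∣m⇒∣n r p))

  reindex-covers : ∀ {m} {T T′ : Fin m → Fin n} (τ : Permutation′ m) → (∀ x → T′ x ≡ T (τ ⟨$⟩ʳ x)) →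
                   Covers T → Covers T′
  reindex-covers {T = T} τ eq cov f Mf with cov f Mf
  ... | x , p = τ ⟨$⟩ˡ x , subst (λ i → N ∣ f i) (sym (trans (eq _) (cong T (inverseʳ τ)))) p

  reindex-irredundant : ∀ {m} {T T′ : Fin m → Fin n} (τ : Permutation′ m) → (∀ x → T′ x ≡ T (τ ⟨$⟩ʳ x)) →
                        Irredundant T → Irredundant T′
  reindex-irredundant {T = T} τ eq irr x with irr (τ ⟨$⟩ʳ x)
  ... | v , Mv , p = v , Mv , λ y y≢x q → p (τ ⟨$⟩ʳ y)
    (λ e → y≢x (trans (sym (inverseˡ τ)) (trans (cong (τ ⟨$⟩ˡ_) e) (inverseˡ τ)))) (subst (λ i → N ∣ v i) (eq y) q)

module Reduction {N : ℕ} .{{_ : NonZero N}} (9≤N : 9 ≤ N) {k : ℕ} (g : Matrix N k 5)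
  (summable : ∀ {f} → Lift ⟨ g ⟩ f → N ∣ sum f)
  (nondeg : ∀ i → ∃[ f ] Lift ⟨ g ⟩ f × ¬ N ∣ f i)
  (avoid : ∀ {p} → Prime p → p ∣ N → ∃[ f ] Lift ⟨ g ⟩ f × ¬ (∀ i → p ∣ f i))
  {c : Fin 5 → ℕ} (Mc : Lift ⟨ g ⟩ c) (order : ∀ s → (∀ i → N ∣ s * c i) → N ∣ s)
  (¬sum : ¬ IsDirectSum ⟨ g ⟩) where

  C : LinearCode N 5
  C = ⟨ g ⟩

  M : Pred (Fin 5 → ℕ) 0ℓ
  M = Lift C

  open Lattice {N} {5} M (lift-0 C) (lift-lin C)

  Goal : Set
  Goal = 2 ∣ N × C ≅ ⟨ exceptional N ⟩

  total : ∀ (σ : Permutation′ 5) {f} → M f → N ∣ sum (λ a → f (σ ⟨$⟩ʳ a))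
  total σ {f} Mf = subst (N ∣_) (sum-permute f σ) (summable Mf)

  finish : ∀ σ → Covers (Shape.T C σ) → Irredundant (Shape.T C σ) →
           ∀ {u} → M u → u (Shape.σ3 C σ) % N ≡ 1 % N →
           ∀ a → (∀ {f} → M f → N ∣ f (Shape.σ3 C σ) → N ∣ f (Shape.T C σ a)) → Goal
  finish σ cov irr {u} Mu u3 a ker =
    Shape.2∣N C σ cov irr (total σ) nondeg ,
    Shape.≅-exceptional C (σ′ a)
      (reindex-covers g (transpose a 2F) (T-eq a) cov) (reindex-irredundant g (transpose a 2F) (T-eq a) irr)
      (total (σ′ a)) nondeg Mu (subst (λ i → u i % N ≡ 1 % N) (sym (σ3-eq a)) u3)
      (λ {f} Mf → subst₂ (λ i j → f i % N ≡ f j * (N / 2) % N) (sym (T2-eq a)) (sym (σ3-eq a))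
        (Shape.forced C σ cov irr (total σ) nondeg Mu u3 a ker Mf))
    where
    σ′ : Fin 3 → Permutation′ 5
    σ′ a = transpose (a ↑ˡ 2) 2F ∘ₚ σ
    σ3-eq : ∀ a → Shape.σ3 C (σ′ a) ≡ Shape.σ3 C σ
    σ3-eq 0F = refl
    σ3-eq 1F = refl
    σ3-eq 2F = refl
    T2-eq : ∀ a → Shape.T C (σ′ a) 2F ≡ Shape.T C σ a
    T2-eq 0F = refl
    T2-eq 1F = refl
    T2-eq 2F = refl
    T-eq : ∀ a x → Shape.T C (σ′ a) x ≡ Shape.T C σ (transpose a 2F ⟨$⟩ʳ x)
    T-eq 0F 0F = refl
    T-eq 0F 1F = refl
    T-eq 0F 2F = refl
    T-eq 1F 0F = refl
    T-eq 1F 1F = refl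
    T-eq 1F 2F = refl
    T-eq 2F 0F = refl
    T-eq 2F 1F = refl
    T-eq 2F 2F = refl

  ¬splits : ∀ σ → ¬ Splits {3} {2} C σ
  ¬splits σ = ¬sum ∘ splits⇒isDirectSum (s≤s z≤n) (s≤s z≤n) C σ

  kernel? : ∀ σ a → Dec (∃[ k ] M k × N ∣ k (Shape.σ3 C σ) × ¬ N ∣ k (Shape.T C σ a))
  kernel? σ a = lift-any? g (λ k → (N ∣? k (Shape.σ3 C σ)) ×-dec ¬? (N ∣? k (Shape.T C σ a)))
    (λ { eq (p , q) → ≈-∣ (eq _) p , q ∘ ≈-∣ (sym (eq _)) })

  module _ (σ : Permutation′ 5) (cov : Covers (Shape.T C σ)) (irr : Irredundant (Shape.T C σ)) where

    open Shape C σ using (T; σ3)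

    odd? : Dec (∃[ f ] M f × ¬ 2 ∣ f σ3)
    odd? = lift-any? g (λ f → ¬? (2 ∣? f σ3))
      (λ eq 2∤f 2∣f′ → 2∤f (∣-resp-≈ (Shape.2∣N C σ cov irr (total σ) nondeg) (sym (eq _)) 2∣f′))

    kernel-case : ∀ {u} → M u → u σ3 % N ≡ 1 % N → Dec (∀ a → ∃[ k ] M k × N ∣ k σ3 × ¬ N ∣ k (T a)) → Goal
    kernel-case Mu u3 (yes ker) = contradiction (Shape.kernel-splits C σ cov irr (total σ) nondeg ker) (¬splits σ)
    kernel-case Mu u3 (no ¬ker) =
      let a , none = ¬∀⟶∃¬ 3 _ (kernel? σ) ¬ker
      in finish σ cov irr Mu u3 a λ {k} Mk k3 →
        decidable-stable (N ∣? k (T a)) λ N∤ka → none (k , Mk , k3 , N∤ka)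

    parity-case : Dec (∃[ f ] M f × ¬ 2 ∣ f σ3) → Goal
    parity-case (no none) = contradiction
      (Shape.even-splits C σ cov irr (total σ) nondeg avoid
        (λ {f} Mf → decidable-stable (2 ∣? f σ3) λ 2∤f → none (f , Mf , 2∤f)))
      (¬splits σ)
    parity-case (yes (f , Mf , 2∤f)) =
      let u , Mu , u3 = Shape.unit-exists C σ cov irr (total σ) nondeg avoid Mf 2∤f
      in kernel-case Mu u3 (all? (kernel? σ))

    cover₃ : Goal
    cover₃ = parity-case odd?

  module _ (r : Fin 5) (cov : Covers (punchIn r)) where

    order′ : ∀ s → (∀ x → N ∣ s * c (punchIn r x)) → N ∣ s
    order′ s killed = order s all
      where
      all : ∀ i → N ∣ s * c i
      all i with r ≟ i
      ... | no r≢i = subst (λ j → N ∣ s * c j) (punchIn-punchOut r≢i) (killed (punchOut r≢i))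
      ... | yes refl = ∣m+n∣n⇒∣m
        (subst (N ∣_) (sum-remove {i = r} (λ j → s * c j)) (summable (lift-lin C (lift-0 C) Mc s)))
        (∣-sum killed)

    ¬irredundant₄ : ¬ Irredundant (punchIn r)
    ¬irredundant₄ irr =
      let z , N∣cz = cov c Mc in
      Irr.¬supported₃ (punchIn r) cov irr 9≤N c Mc order′ (punchIn z) (supported-punchIn (punchIn r) cov irr z c N∣cz)

    cover₄ : Irredundant (punchIn r) ⊎ (∃[ s ] Covers (punchIn r ∘ punchIn s)) → Goal
    cover₄ (inj₁ irr) = contradiction irr ¬irredundant₄
    cover₄ (inj₂ (s , cov′)) with covers-step g (punchIn r ∘ punchIn s) cov′
    ... | inj₂ (t , cov″) = contradiction cov″ (¬covers₂ g nondeg _)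
    ... | inj₁ irr = cover₃ σ (reindex-covers g Perm.id T-eq cov′) (reindex-irredundant g Perm.id T-eq irr)
      where
      π : Permutation′ 4
      π = insert 3F s Perm.id
      σ : Permutation′ 5
      σ = insert 4F r π
      T-eq : ∀ x → Shape.T C σ x ≡ punchIn r (punchIn s x)
      T-eq 0F = trans (insert-punchIn 4F r π 0F) (cong (punchIn r) (insert-punchIn 3F s Perm.id 0F))
      T-eq 1F = trans (insert-punchIn 4F r π 1F) (cong (punchIn r) (insert-punchIn 3F s Perm.id 1F))
      T-eq 2F = trans (insert-punchIn 4F r π 2F) (cong (punchIn r) (insert-punchIn 3F s Perm.id 2F))

  ¬irredundant₅ : Covers id → ¬ Irredundant id
  ¬irredundant₅ cov irr =
    let z , N∣cz = cov c Mc in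
    Irr.¬supported₄ id cov irr 9≤N c Mc order (punchIn z) (supported-punchIn id cov irr z c N∣cz)

  cover₅ : Covers id → Goal
  cover₅ cov with covers-step g id cov
  ... | inj₁ irr        = contradiction irr (¬irredundant₅ cov)
  ... | inj₂ (r , cov′) = cover₄ r cov′ (covers-step g (punchIn r) cov′)

proposition3p5 : ∀ (N : ℕ) .{{_ : NonZero N}} → 9 ≤ N →
    ∀ (k : ℕ) → k ≡ 3 ⊎ k ≡ 4 →
    ∀ (g : Matrix N k 5) →
    Admissible ⟨ g ⟩ →
    ¬ Degenerate ⟨ g ⟩ →
    ¬ IsDirectSum ⟨ g ⟩ →
    Thin ⟨ g ⟩ →
    2 ∣ N × ⟨ g ⟩ ≅ ⟨ exceptional N ⟩
proposition3p5 N 9≤N k _ g (ext , isGCD) ¬deg ¬sum thin =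
  let avoid = prime-avoided g isGCD
      c , Mc , prim = primitive-exists N (Lift ⟨ g ⟩) (lift-0 ⟨ g ⟩) (lift-lin ⟨ g ⟩) id avoid
  in Reduction.cover₅ 9≤N g (extended-sum g ext) (nonDegenerate g ¬deg) avoid Mc (primitive-order N prim) ¬sum (thin-covers g thin)
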